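{- Every typed term of the simply typed symmetric $\lambda\mu$-calculus is strongly normalizing for the $\beta\mu\mu'$-reduction, i.e. there is no infinite sequence of $\beta\mu\mu'$-reduction steps starting from it.
   Context: Terms of the symmetric $\lambda\mu$-calculus are given by $\mathcal{T} ::= x \mid \lambda x\,\mathcal{T}\mid(\mathcal{T}\;\mathcal{T})\mid\mu\alpha\,\mathcal{T}\mid(\alpha\;\mathcal{T})$, where $x,y,\dots$ are $\lambda$-variables and $\alpha,\beta,\dots$ are $\mu$-variables; $\lambda x$ and $\mu\alpha$ are binders, terms are considered up to renaming of bound variables and all substitutions are capture-avoiding. Types are built from atomic formulas and the constant $\bot$ with the connective $\rightarrow$; $\neg A$ abbreviates $A\rightarrow\bot$. A context $\Gamma$ is a set of declarations $x:A$ and $\alpha:\neg A$. Typing rules: - $\Gamma,x:A\vdash x:A$; - from $\Gamma,x:A\vdash M:B$ infer $\Gamma\vdash\lambda x\,M:A\rightarrow B$; - from $\Gamma\vdash M:A\rightarrow B$ and $\Gamma\vdash N:A$ infer $\Gamma\vdash(M\;N):B$; - from $\Gamma,\alpha:\neg A\vdash M:\bot$ infer $\Gamma\vdash\mu\alpha\,M:A$; - from $\Gamma,\alpha:\neg A\vdash M:A$ infer $\Gamma,\alpha:\neg A\vdash(\alpha\;M):\bot$. A term is typed if $\Gamma\vdash M:A$ is derivable for some $\Gamma,A$. $M[\alpha=_rN]$ (resp. $M[\alpha=_lN]$) is obtained from $M$ by replacing (recursively) each sub-term of the form $(\alpha\;U)$ by $(\alpha\;(U\;N))$ (resp. $(\alpha\;(N\;U))$).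 The $\beta\mu\mu'$-reduction is the closure under all term constructors of: $(\lambda x\,M\;N)\triangleright_\beta M[x:=N]$; $(\mu\alpha\,M\;N)\triangleright_\mu\mu\alpha\,M[\alpha=_rN]$; $(N\;\mu\alpha\,M)\triangleright_{\mu'}\mu\alpha\,M[\alpha=_lN]$. -}

module Defs where

open import Data.Fin using (Fin; zero; suc)
open import Data.Fin.Properties using (_≟_)
open import Data.Nat using (ℕ; suc)
open import Data.Product using (∃-syntax)
open import Data.Vec using (Vec; _∷_; _[_]=_)
open import Function using (id; flip)
open import Induction.InfiniteDescent using (InfiniteDescendingSequenceFrom)
open import Level using (0ℓ)
open import Relation.Binary.Core using (Rel)
open import Relation.Nullary using (¬_; yes; no)

infixr 7 _⇒_
infixl 8 _·_
infix  9 _[_]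
infix  9 _[_=r_] _[_=l_]
infix  4 _∣_⊢_∶_
infix  4 _▷_

-- Terms up to renaming of bound variables, in well-scoped de Bruijn form with
-- two separate index spaces: a Term m n has its free λ-variables among m and
-- its free μ-variables among n. ⟨ α ⟩ M is the term (α M).

data Term (m n : ℕ) : Set where
  var  : Fin m → Term m n
  ƛ    : Term (suc m) n → Term m n
  _·_  : Term m n → Term m n → Term m n
  μ    : Term m (suc n) → Term m n
  ⟨_⟩_ : Fin n → Term m n → Term m n

private
  variable
    m n m′ n′ : ℕ

lift : (Fin m → Fin m′) → Fin (suc m) → Fin (suc m′)
lift ρ zero    = zero
lift ρ (suc x) = suc (ρ x)

rename : (Fin m → Fin m′) → (Fin n → Fin n′) → Term m n → Term m′ n′
rename ρ θ (var x)   = var (ρ x)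
rename ρ θ (ƛ M)     = ƛ (rename (lift ρ) θ M)
rename ρ θ (M · N)   = rename ρ θ M · rename ρ θ N
rename ρ θ (μ M)     = μ (rename ρ (lift θ) M)
rename ρ θ (⟨ α ⟩ M) = ⟨ θ α ⟩ rename ρ θ M

wkλ : Term m n → Term (suc m) n
wkλ = rename suc id

wkμ : Term m n → Term m (suc n)
wkμ = rename id suc

liftₛ : (Fin m → Term m′ n) → Fin (suc m) → Term (suc m′) n
liftₛ σ zero    = var zero
liftₛ σ (suc x) = wkλ (σ x)

substitute : (Fin m → Term m′ n) → Term m n → Term m′ n
substitute σ (var x)   = σ x
substitute σ (ƛ M)     = ƛ (substitute (liftₛ σ) M)
substitute σ (M · N)   = substitute σ M · substitute σ N
substitute σ (μ M)     = μ (substitute (λ x → wkμ (σ x)) M)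
substitute σ (⟨ α ⟩ M) = ⟨ α ⟩ substitute σ M

-- M [ N ] is M[x:=N] for x the λ-variable of index zero, which disappears.

single : Term m n → Fin (suc m) → Term m n
single N zero    = N
single N (suc x) = var x

_[_] : Term (suc m) n → Term m n → Term m n
M [ N ] = substitute (single N) M

-- The variable α remains in scope in M[α =r N] and M[α =l N].

_[_=r_] : Term m n → Fin n → Term m n → Term m n
var x     [ α =r N ] = var x
ƛ M       [ α =r N ] = ƛ (M [ α =r wkλ N ])
(M · P)   [ α =r N ] = (M [ α =r N ]) · (P [ α =r N ])
μ M       [ α =r N ] = μ (M [ suc α =r wkμ N ])
(⟨ β ⟩ U) [ α =r N ] with β ≟ α
... | yes _ = ⟨ β ⟩ ((U [ α =r N ]) · N)
... | no  _ = ⟨ β ⟩ (U [ α =r N ])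

_[_=l_] : Term m n → Fin n → Term m n → Term m n
var x     [ α =l N ] = var x
ƛ M       [ α =l N ] = ƛ (M [ α =l wkλ N ])
(M · P)   [ α =l N ] = (M [ α =l N ]) · (P [ α =l N ])
μ M       [ α =l N ] = μ (M [ suc α =l wkμ N ])
(⟨ β ⟩ U) [ α =l N ] with β ≟ α
... | yes _ = ⟨ β ⟩ (N · (U [ α =l N ]))
... | no  _ = ⟨ β ⟩ (U [ α =l N ])

-- N is weakened in the μ- and μ′-rules because it moves under the binder μ.

data _▷_ {m n : ℕ} : Rel (Term m n) 0ℓ where
  β-red  : ∀ {M N} → ƛ M · N ▷ M [ N ]
  μ-red  : ∀ {M N} → μ M · N ▷ μ (M [ zero =r wkμ N ])
  μ′-red : ∀ {M N} → N · μ M ▷ μ (M [ zero =l wkμ N ])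
  ƛ-cong  : ∀ {M M′} → M ▷ M′ → ƛ M ▷ ƛ M′
  ·-congˡ : ∀ {M M′ N} → M ▷ M′ → M · N ▷ M′ · N
  ·-congʳ : ∀ {M N N′} → N ▷ N′ → M · N ▷ M · N′
  μ-cong  : ∀ {M M′} → M ▷ M′ → μ M ▷ μ M′
  ⟨⟩-cong : ∀ {α M M′} → M ▷ M′ → ⟨ α ⟩ M ▷ ⟨ α ⟩ M′

data Type : Set where
  atom : ℕ → Type
  ⊥    : Type
  _⇒_  : Type → Type → Type

Context : ℕ → Set
Context = Vec Type

-- A context is split into its λ-part Γ and its μ-part Δ. Every declaration of
-- a μ-variable has the form α : ¬ A, and Δ records just the A.

data _∣_⊢_∶_ {m n : ℕ} (Γ : Context m) (Δ : Context n) : Term m n → Type → Set where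
  ⊢var : ∀ {x A} → Γ [ x ]= A → Γ ∣ Δ ⊢ var x ∶ A
  ⊢ƛ   : ∀ {M A B} → A ∷ Γ ∣ Δ ⊢ M ∶ B → Γ ∣ Δ ⊢ ƛ M ∶ A ⇒ B
  ⊢·   : ∀ {M N A B} → Γ ∣ Δ ⊢ M ∶ A ⇒ B → Γ ∣ Δ ⊢ N ∶ A → Γ ∣ Δ ⊢ M · N ∶ B
  ⊢μ   : ∀ {M A} → Γ ∣ A ∷ Δ ⊢ M ∶ ⊥ → Γ ∣ Δ ⊢ μ M ∶ A
  ⊢⟨⟩  : ∀ {α M A} → Δ [ α ]= A → Γ ∣ Δ ⊢ M ∶ A → Γ ∣ Δ ⊢ ⟨ α ⟩ M ∶ ⊥

Typed : Term m n → Set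
Typed {m} {n} M = ∃[ Γ ] ∃[ Δ ] ∃[ A ] (Γ ∣ Δ ⊢ M ∶ A)

-- The library's sequences satisfy f (suc i) < f i, hence the flip.

StronglyNormalizing : Term m n → Set
StronglyNormalizing M = ¬ (∃[ f ] InfiniteDescendingSequenceFrom (flip _▷_) f M)

{-# OPTIONS --safe #-}
module Submission where

-- The proof avoids reducibility candidates defined as fixed points. Call a term "good" of
-- type A if it is SN and, whenever it evaluates to μα P, replacing each (α U) in P by
-- α E[U] gives an SN term for every stack E of applications with a hole of type A such
-- that E[y] is SN. By induction on A one shows:
--   (1) if M is SN and good terms of type A are substituted for variables, the result is SN;
--   (2) every SN term of type A is good.
-- For (1), if an instantiated variable x comes to the head of M = E[x] and contributes a
-- μ-abstraction, goodness applies, E[y] being handled by induction; if it contributes a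
-- λ-abstraction, then A = A₁ → A₂ and (1), (2) for A₁ and A₂ apply. For (2), one shows by
-- induction on M that M stays SN when stacks are pushed through its μ-variables: (α U)
-- becomes α E[U], where U is good by induction, so that (1) applies to E[y].

open import Defs
open import Data.Fin using (Fin; zero; suc)
open import Data.Fin.Properties using (_≟_)
open import Data.List using (List; []; _∷_; _++_; map)
open import Data.List.Properties using (map-∘; map-cong; map-id; map-++; ++-identityʳ)
open import Data.List.Relation.Binary.Pointwise using (Pointwise; []; _∷_)
open import Data.Nat using (ℕ; zero; suc; _+_; _<_)
open import Data.Nat.Induction using (<-wellFounded)
open import Data.Nat.Properties using (≤-reflexive; ≤-trans; m≤m+n; +-mono-<-≤; +-mono-≤-<)
open import Data.Product using (Σ; ∃; ∃₂; _×_; _,_; proj₁; proj₂)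
open import Data.Sum using (_⊎_; inj₁; inj₂)
open import Data.Vec as Vec using ([]; _∷_; here; there)
open import Function using (id; _∘_)
open import Induction.WellFounded using (Acc; acc; acc-inverse)
open import Relation.Binary.Construct.Closure.ReflexiveTransitive using (Star; ε; _◅_; _◅◅_; gmap)
open import Relation.Binary.Construct.Closure.Transitive
  using (TransClosure; _∷_; _∷ʳ_; accessible)
  renaming ([_] to ⟦_⟧)
open import Relation.Binary.PropositionalEquality
  using (_≡_; _≢_; _≗_; refl; sym; trans; cong; cong₂; subst; subst₂)
open import Relation.Nullary using (¬_; yes; no; contradiction)

private
  variable
    m n m′ n′ m″ n″ : ℕ

-- Stacks and simultaneous substitution

-- Both sides of an application occur as frames, since a μ-abstraction absorbs an argument by the
-- μ-rule and a function by the μ′-rule.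
data Frame (m n : ℕ) : Set where
  argF funF : Term m n → Frame m n

Stack : ℕ → ℕ → Set
Stack m n = List (Frame m n)

fill : Frame m n → Term m n → Term m n
fill (argF N) M = M · N
fill (funF N) M = N · M

plug : Stack m n → Term m n → Term m n
plug []      M = M
plug (f ∷ E) M = plug E (fill f M)

mapF : (Term m n → Term m′ n′) → Frame m n → Frame m′ n′
mapF f (argF N) = argF (f N)
mapF f (funF N) = funF (f N)

mapE : (Term m n → Term m′ n′) → Stack m n → Stack m′ n′
mapE f = map (mapF f)

plug-++ : ∀ (E E′ : Stack m n) {M} → plug (E ++ E′) M ≡ plug E′ (plug E M)
plug-++ []      E′ = refl
plug-++ (f ∷ E) E′ = plug-++ E E′

mapF-cong : {f g : Term m n → Term m′ n′} → f ≗ g → mapF f ≗ mapF g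
mapF-cong h (argF N) = cong argF (h N)
mapF-cong h (funF N) = cong funF (h N)

mapE-cong : {f g : Term m n → Term m′ n′} → f ≗ g → mapE f ≗ mapE g
mapE-cong h = map-cong (mapF-cong h)

mapE-∘ : {f : Term m n → Term m′ n′} {g : Term m′ n′ → Term m″ n″} →
         ∀ E → mapE g (mapE f E) ≡ mapE (g ∘ f) E
mapE-∘ E = trans (sym (map-∘ E)) (map-cong (λ { (argF _) → refl ; (funF _) → refl }) E)

mapE-id : {f : Term m n → Term m n} → f ≗ id → mapE f ≗ id
mapE-id h E = trans (map-cong (λ { (argF N) → cong argF (h N) ; (funF N) → cong funF (h N) }) E) (map-id E)

-- A substitution replaces x by tm x and (α U) by (co α  (st α)[U]), so that it
-- covers M[x:=N], M[α =r N], M[α =l N] and their iterations at once.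

record Sub (m n m′ n′ : ℕ) : Set where
  constructor ⟪_,_,_⟫
  field
    tm : Fin m → Term m′ n′
    co : Fin n → Fin n′
    st : Fin n → Stack m′ n′

open Sub

infix 4 _≈_
record _≈_ (θ θ′ : Sub m n m′ n′) : Set where
  constructor ⟪_,_,_⟫
  field
    tm≈ : tm θ ≗ tm θ′
    co≈ : co θ ≗ co θ′
    st≈ : st θ ≗ st θ′

infix 10 _↑λ _↑μ

_↑λ : Sub m n m′ n′ → Sub (suc m) n (suc m′) n′
θ ↑λ = ⟪ liftₛ (tm θ) , co θ , mapE wkλ ∘ st θ ⟫

liftᵉ : (Fin n → Stack m′ n′) → Fin (suc n) → Stack m′ (suc n′)
liftᵉ s zero    = []
liftᵉ s (suc α) = mapE wkμ (s α)

_↑μ : Sub m n m′ n′ → Sub m (suc n) m′ (suc n′)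
θ ↑μ = ⟪ wkμ ∘ tm θ , lift (co θ) , liftᵉ (st θ) ⟫

sub : Sub m n m′ n′ → Term m n → Term m′ n′
sub θ (var x)   = tm θ x
sub θ (ƛ M)     = ƛ (sub (θ ↑λ) M)
sub θ (M · N)   = sub θ M · sub θ N
sub θ (μ M)     = μ (sub (θ ↑μ) M)
sub θ (⟨ α ⟩ M) = ⟨ co θ α ⟩ plug (st θ α) (sub θ M)

subE : Sub m n m′ n′ → Stack m n → Stack m′ n′
subE θ = mapE (sub θ)

renE : (Fin m → Fin m′) → (Fin n → Fin n′) → Stack m n → Stack m′ n′
renE ρ ϑ = mapE (rename ρ ϑ)

lift-cong : {f g : Fin n → Fin n′} → f ≗ g → lift f ≗ lift g
lift-cong h zero    = refl
lift-cong h (suc x) = cong suc (h x)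

lift-id : {f : Fin n → Fin n} → f ≗ id → lift f ≗ id
lift-id h zero    = refl
lift-id h (suc x) = cong suc (h x)

↑λ-cong : {θ θ′ : Sub m n m′ n′} → θ ≈ θ′ → θ ↑λ ≈ θ′ ↑λ
↑λ-cong ⟪ t , c , s ⟫ = ⟪ (λ { zero → refl ; (suc x) → cong wkλ (t x) }) , c , cong (mapE wkλ) ∘ s ⟫

↑μ-cong : {θ θ′ : Sub m n m′ n′} → θ ≈ θ′ → θ ↑μ ≈ θ′ ↑μ
↑μ-cong ⟪ t , c , s ⟫ =
  ⟪ cong wkμ ∘ t , lift-cong c , (λ { zero → refl ; (suc α) → cong (mapE wkμ) (s α) }) ⟫

sub-cong : {θ θ′ : Sub m n m′ n′} → θ ≈ θ′ → sub θ ≗ sub θ′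
sub-cong h (var x)   = _≈_.tm≈ h x
sub-cong h (ƛ M)     = cong ƛ (sub-cong (↑λ-cong h) M)
sub-cong h (M · N)   = cong₂ _·_ (sub-cong h M) (sub-cong h N)
sub-cong h (μ M)     = cong μ (sub-cong (↑μ-cong h) M)
sub-cong h (⟨ α ⟩ M)
  rewrite _≈_.co≈ h α | _≈_.st≈ h α | sub-cong h M = refl

rename-cong : {ρ ρ′ : Fin m → Fin m′} {ϑ ϑ′ : Fin n → Fin n′} →
              ρ ≗ ρ′ → ϑ ≗ ϑ′ → rename ρ ϑ ≗ rename ρ′ ϑ′
rename-cong h k (var x)   = cong var (h x)
rename-cong h k (ƛ M)     = cong ƛ (rename-cong (lift-cong h) k M)
rename-cong h k (M · N)   = cong₂ _·_ (rename-cong h k M) (rename-cong h k N)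
rename-cong h k (μ M)     = cong μ (rename-cong h (lift-cong k) M)
rename-cong h k (⟨ α ⟩ M) = cong₂ ⟨_⟩_ (k α) (rename-cong h k M)

lift-∘ : {f : Fin m → Fin m′} {g : Fin m′ → Fin m″} → lift g ∘ lift f ≗ lift (g ∘ f)
lift-∘ zero    = refl
lift-∘ (suc x) = refl

rename-rename : {ρ : Fin m → Fin m′} {ϑ : Fin n → Fin n′} {ρ′ : Fin m′ → Fin m″} {ϑ′ : Fin n′ → Fin n″} →
                ∀ M → rename ρ′ ϑ′ (rename ρ ϑ M) ≡ rename (ρ′ ∘ ρ) (ϑ′ ∘ ϑ) M
rename-rename (var x)   = refl
rename-rename (ƛ M)     = cong ƛ (trans (rename-rename M) (rename-cong lift-∘ (λ _ → refl) M))
rename-rename (M · N)   = cong₂ _·_ (rename-rename M) (rename-rename N)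
rename-rename (μ M)     = cong μ (trans (rename-rename M) (rename-cong (λ _ → refl) lift-∘ M))
rename-rename (⟨ α ⟩ M) = cong (⟨ _ ⟩_) (rename-rename M)

rename-plug : {ρ : Fin m → Fin m′} {ϑ : Fin n → Fin n′} →
              ∀ E {M} → rename ρ ϑ (plug E M) ≡ plug (renE ρ ϑ E) (rename ρ ϑ M)
rename-plug []           = refl
rename-plug (argF N ∷ E) = rename-plug E
rename-plug (funF N ∷ E) = rename-plug E

sub-plug : (θ : Sub m n m′ n′) → ∀ E {M} → sub θ (plug E M) ≡ plug (subE θ E) (sub θ M)
sub-plug θ []           = refl
sub-plug θ (argF N ∷ E) = sub-plug θ E
sub-plug θ (funF N ∷ E) = sub-plug θ E

infixl 9 _∘ʳ_
_∘ʳ_ : Sub m′ n′ m″ n″ → (Fin m → Fin m′) × (Fin n → Fin n′) → Sub m n m″ n″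
θ ∘ʳ (ρ , ϑ) = ⟪ tm θ ∘ ρ , co θ ∘ ϑ , st θ ∘ ϑ ⟫

sub-rename : {θ : Sub m′ n′ m″ n″} {ρ : Fin m → Fin m′} {ϑ : Fin n → Fin n′} →
             ∀ M → sub θ (rename ρ ϑ M) ≡ sub (θ ∘ʳ (ρ , ϑ)) M
sub-rename (var x)   = refl
sub-rename (ƛ M)     = cong ƛ (trans (sub-rename M)
  (sub-cong ⟪ (λ { zero → refl ; (suc _) → refl }) , (λ _ → refl) , (λ _ → refl) ⟫ M))
sub-rename (M · N)   = cong₂ _·_ (sub-rename M) (sub-rename N)
sub-rename (μ M)     = cong μ (trans (sub-rename M)
  (sub-cong ⟪ (λ _ → refl) , (λ { zero → refl ; (suc _) → refl }) , (λ { zero → refl ; (suc _) → refl }) ⟫ M))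
sub-rename {θ = θ} {ϑ = ϑ} (⟨ α ⟩ M) = cong (λ X → ⟨ _ ⟩ plug (st θ (ϑ α)) X) (sub-rename M)

infixl 9 _ʳ∘_
_ʳ∘_ : (Fin m′ → Fin m″) × (Fin n′ → Fin n″) → Sub m n m′ n′ → Sub m n m″ n″
(ρ , ϑ) ʳ∘ θ = ⟪ rename ρ ϑ ∘ tm θ , ϑ ∘ co θ , renE ρ ϑ ∘ st θ ⟫

rename-wkλ : {ρ : Fin m → Fin m′} {ϑ : Fin n → Fin n′} →
             ∀ M → rename (lift ρ) ϑ (wkλ M) ≡ wkλ (rename ρ ϑ M)
rename-wkλ M = trans (rename-rename M) (sym (rename-rename M))

rename-wkμ : {ρ : Fin m → Fin m′} {ϑ : Fin n → Fin n′} →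
             ∀ M → rename ρ (lift ϑ) (wkμ M) ≡ wkμ (rename ρ ϑ M)
rename-wkμ M = trans (rename-rename M) (sym (rename-rename M))

mapE-comm : {f : Term m n → Term m′ n′} {g : Term m′ n′ → Term m″ n″}
            {k l : ℕ} {f′ : Term m n → Term k l} {g′ : Term k l → Term m″ n″} →
            g ∘ f ≗ g′ ∘ f′ → ∀ E → mapE g (mapE f E) ≡ mapE g′ (mapE f′ E)
mapE-comm h E = trans (mapE-∘ E) (trans (mapE-cong h E) (sym (mapE-∘ E)))

rename-sub : {θ : Sub m n m′ n′} {ρ : Fin m′ → Fin m″} {ϑ : Fin n′ → Fin n″} →
             ∀ M → rename ρ ϑ (sub θ M) ≡ sub ((ρ , ϑ) ʳ∘ θ) M
rename-sub (var x)   = refl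
rename-sub {θ = θ} (ƛ M) = cong ƛ (trans (rename-sub M)
  (sub-cong ⟪ (λ { zero → refl ; (suc x) → rename-wkλ (tm θ x) }) , (λ _ → refl)
            , (λ α → mapE-comm rename-wkλ (st θ α)) ⟫ M))
rename-sub (M · N)   = cong₂ _·_ (rename-sub M) (rename-sub N)
rename-sub {θ = θ} (μ M) = cong μ (trans (rename-sub M)
  (sub-cong ⟪ (λ x → rename-wkμ (tm θ x)) , (λ { zero → refl ; (suc _) → refl })
            , (λ { zero → refl ; (suc α) → mapE-comm rename-wkμ (st θ α) }) ⟫ M))
rename-sub {θ = θ} (⟨ α ⟩ M) = cong (⟨ _ ⟩_)
  (trans (rename-plug (st θ α)) (cong (plug (renE _ _ (st θ α))) (rename-sub M)))

sub-wkλ : (θ : Sub m n m′ n′) → ∀ M → sub (θ ↑λ) (wkλ M) ≡ wkλ (sub θ M)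
sub-wkλ θ M = trans (sub-rename M) (sym (rename-sub M))

sub-wkμ : (θ : Sub m n m′ n′) → ∀ M → sub (θ ↑μ) (wkμ M) ≡ wkμ (sub θ M)
sub-wkμ θ M = trans (sub-rename M) (sym (rename-sub M))

infixl 9 _∘ₛ_
-- Stacks compose by concatenation: the frames coming from `θ` lie closer to the hole, and those
-- that `θ′` attaches to the renamed variable come after them.
_∘ₛ_ : Sub m′ n′ m″ n″ → Sub m n m′ n′ → Sub m n m″ n″
θ′ ∘ₛ θ = ⟪ sub θ′ ∘ tm θ , co θ′ ∘ co θ , (λ α → subE θ′ (st θ α) ++ st θ′ (co θ α)) ⟫

sub-sub : {θ : Sub m n m′ n′} {θ′ : Sub m′ n′ m″ n″} →
          ∀ M → sub θ′ (sub θ M) ≡ sub (θ′ ∘ₛ θ) M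
sub-sub (var x)   = refl
sub-sub {θ = θ} {θ′} (ƛ M) = cong ƛ (trans (sub-sub M)
  (sub-cong ⟪ (λ { zero → refl ; (suc x) → sub-wkλ θ′ (tm θ x) }) , (λ _ → refl)
            , (λ α → trans (cong (_++ _) (mapE-comm (sub-wkλ θ′) (st θ α)))
                           (sym (map-++ (mapF wkλ) (subE θ′ (st θ α)) _))) ⟫ M))
sub-sub (M · N)   = cong₂ _·_ (sub-sub M) (sub-sub N)
sub-sub {θ = θ} {θ′} (μ M) = cong μ (trans (sub-sub M)
  (sub-cong ⟪ (λ x → sub-wkμ θ′ (tm θ x)) , (λ { zero → refl ; (suc _) → refl })
            , (λ { zero → refl
                 ; (suc α) → trans (cong (_++ _) (mapE-comm (sub-wkμ θ′) (st θ α)))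
                                   (sym (map-++ (mapF wkμ) (subE θ′ (st θ α)) _)) }) ⟫ M))
sub-sub {θ = θ} {θ′} (⟨ α ⟩ M) = cong (⟨ _ ⟩_)
  (trans (cong (plug (st θ′ (co θ α))) (trans (sub-plug θ′ (st θ α)) (cong (plug (subE θ′ (st θ α))) (sub-sub M))))
         (sym (plug-++ (subE θ′ (st θ α)) _)))

ren : (Fin m → Fin m′) → (Fin n → Fin n′) → Sub m n m′ n′
ren ρ ϑ = ⟪ var ∘ ρ , ϑ , (λ _ → []) ⟫

idₛ : Sub m n m n
idₛ = ren id id

sub-≈ren : {θ : Sub m n m′ n′} {ρ : Fin m → Fin m′} {ϑ : Fin n → Fin n′} →
           θ ≈ ren ρ ϑ → sub θ ≗ rename ρ ϑ
sub-≈ren h (var x)   = _≈_.tm≈ h x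
sub-≈ren ⟪ t , c , s ⟫ (ƛ M) = cong ƛ (sub-≈ren
  ⟪ (λ { zero → refl ; (suc x) → cong wkλ (t x) }) , c , (λ α → cong (mapE wkλ) (s α)) ⟫ M)
sub-≈ren h (M · N)   = cong₂ _·_ (sub-≈ren h M) (sub-≈ren h N)
sub-≈ren ⟪ t , c , s ⟫ (μ M) = cong μ (sub-≈ren
  ⟪ (λ x → cong wkμ (t x)) , (λ { zero → refl ; (suc α) → cong suc (c α) })
  , (λ { zero → refl ; (suc α) → cong (mapE wkμ) (s α) }) ⟫ M)
sub-≈ren h (⟨ α ⟩ M)
  rewrite _≈_.co≈ h α | _≈_.st≈ h α | sub-≈ren h M = refl

sub-ren : {ρ : Fin m → Fin m′} {ϑ : Fin n → Fin n′} → sub (ren ρ ϑ) ≗ rename ρ ϑ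
sub-ren = sub-≈ren ⟪ (λ _ → refl) , (λ _ → refl) , (λ _ → refl) ⟫

rename-id : {ρ : Fin m → Fin m} {ϑ : Fin n → Fin n} → ρ ≗ id → ϑ ≗ id → rename ρ ϑ ≗ id
rename-id h k (var x)   = cong var (h x)
rename-id h k (ƛ M)     = cong ƛ (rename-id (lift-id h) k M)
rename-id h k (M · N)   = cong₂ _·_ (rename-id h k M) (rename-id h k N)
rename-id h k (μ M)     = cong μ (rename-id h (lift-id k) M)
rename-id h k (⟨ α ⟩ M) = cong₂ ⟨_⟩_ (k α) (rename-id h k M)

sub-id : sub (idₛ {m} {n}) ≗ id
sub-id M = trans (sub-ren M) (rename-id (λ _ → refl) (λ _ → refl) M)

-- The substitutions of the three reduction rules

inst : Term m n → Sub (suc m) n m n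
inst N = ⟪ single N , id , (λ _ → []) ⟫

push-st : Stack m n → Fin (suc n) → Stack m (suc n)
push-st E zero    = mapE wkμ E
push-st E (suc _) = []

push : Stack m n → Sub m (suc n) m (suc n)
push E = ⟪ var , id , push-st E ⟫

substitute≡sub : {θ : Sub m n m′ n} {σ : Fin m → Term m′ n} →
                 θ ≈ ⟪ σ , id , (λ _ → []) ⟫ → substitute σ ≗ sub θ
substitute≡sub h (var x)   = sym (_≈_.tm≈ h x)
substitute≡sub ⟪ t , c , s ⟫ (ƛ M) = cong ƛ (substitute≡sub
  ⟪ (λ { zero → refl ; (suc x) → cong wkλ (t x) }) , c , (λ α → cong (mapE wkλ) (s α)) ⟫ M)
substitute≡sub h (M · N)   = cong₂ _·_ (substitute≡sub h M) (substitute≡sub h N)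
substitute≡sub ⟪ t , c , s ⟫ (μ M) = cong μ (substitute≡sub
  ⟪ (λ x → cong wkμ (t x)) , (λ { zero → refl ; (suc α) → cong suc (c α) })
  , (λ { zero → refl ; (suc α) → cong (mapE wkμ) (s α) }) ⟫ M)
substitute≡sub h (⟨ α ⟩ M)
  rewrite _≈_.co≈ h α | _≈_.st≈ h α | substitute≡sub h M = refl

[]≡inst : ∀ (M : Term (suc m) n) N → M [ N ] ≡ sub (inst N) M
[]≡inst M N = substitute≡sub ⟪ (λ _ → refl) , (λ _ → refl) , (λ _ → refl) ⟫ M

-- A pointwise description for arbitrary `α`, since crossing a μ turns the variable into `suc α`,
-- and the lifted substitution is no longer of the form `push E`.
record Pushes (α : Fin n) (f : Frame m n) (θ : Sub m n m n) : Set where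
  constructor pushes
  field
    tm≡   : ∀ x → tm θ x ≡ var x
    co≡   : ∀ β → co θ β ≡ β
    st≡   : st θ α ≡ f ∷ []
    st≢   : ∀ {β} → β ≢ α → st θ β ≡ []

pushes-↑λ : ∀ {α : Fin n} {f : Frame m n} {θ} → Pushes α f θ → Pushes α (mapF wkλ f) (θ ↑λ)
pushes-↑λ (pushes t c s s′) = pushes (λ { zero → refl ; (suc x) → cong wkλ (t x) }) c
  (cong (mapE wkλ) s) (λ ne → cong (mapE wkλ) (s′ ne))

pushes-↑μ : ∀ {α : Fin n} {f : Frame m n} {θ} → Pushes α f θ → Pushes (suc α) (mapF wkμ f) (θ ↑μ)
pushes-↑μ (pushes t c s s′) = pushes (λ x → cong wkμ (t x)) (λ { zero → refl ; (suc β) → cong suc (c β) })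
  (cong (mapE wkμ) s) (λ { {zero} _ → refl ; {suc β} ne → cong (mapE wkμ) (s′ (ne ∘ cong suc)) })

=r≡sub : ∀ {α : Fin n} {N : Term m n} {θ} → Pushes α (argF N) θ → ∀ M → M [ α =r N ] ≡ sub θ M
=r≡sub h (var x) = sym (Pushes.tm≡ h x)
=r≡sub h (ƛ M)   = cong ƛ (=r≡sub (pushes-↑λ h) M)
=r≡sub h (M · N) = cong₂ _·_ (=r≡sub h M) (=r≡sub h N)
=r≡sub h (μ M)   = cong μ (=r≡sub (pushes-↑μ h) M)
=r≡sub {α = α} h (⟨ β ⟩ M) with β ≟ α
... | yes refl rewrite Pushes.co≡ h β | Pushes.st≡ h | =r≡sub h M = refl
... | no ne    rewrite Pushes.co≡ h β | Pushes.st≢ h ne | =r≡sub h M = refl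

=l≡sub : ∀ {α : Fin n} {N : Term m n} {θ} → Pushes α (funF N) θ → ∀ M → M [ α =l N ] ≡ sub θ M
=l≡sub h (var x) = sym (Pushes.tm≡ h x)
=l≡sub h (ƛ M)   = cong ƛ (=l≡sub (pushes-↑λ h) M)
=l≡sub h (M · N) = cong₂ _·_ (=l≡sub h M) (=l≡sub h N)
=l≡sub h (μ M)   = cong μ (=l≡sub (pushes-↑μ h) M)
=l≡sub {α = α} h (⟨ β ⟩ M) with β ≟ α
... | yes refl rewrite Pushes.co≡ h β | Pushes.st≡ h | =l≡sub h M = refl
... | no ne    rewrite Pushes.co≡ h β | Pushes.st≢ h ne | =l≡sub h M = refl

push-pushes : ∀ (f : Frame m n) → Pushes zero (mapF wkμ f) (push (f ∷ []))
push-pushes f = pushes (λ _ → refl) (λ _ → refl) refl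
  (λ { {zero} ne → contradiction refl ne ; {suc _} _ → refl })

=r≡push : ∀ (M : Term m (suc n)) N → M [ zero =r wkμ N ] ≡ sub (push (argF N ∷ [])) M
=r≡push M N = =r≡sub (push-pushes (argF N)) M

=l≡push : ∀ (M : Term m (suc n)) N → M [ zero =l wkμ N ] ≡ sub (push (funF N ∷ [])) M
=l≡push M N = =l≡sub (push-pushes (funF N)) M

inst-wkλ : ∀ (N : Term m n) M → sub (inst N) (wkλ M) ≡ M
inst-wkλ N M = trans (sub-rename M) (sub-id M)

push-wkμ : ∀ (E : Stack m n) M → sub (push E) (wkμ M) ≡ wkμ M
push-wkμ E M = trans (sub-rename M) (sub-ren M)

sub-inst : ∀ (θ : Sub m n m′ n′) N M → sub θ (sub (inst N) M) ≡ sub (inst (sub θ N)) (sub (θ ↑λ) M)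
sub-inst θ N M = trans (sub-sub M) (trans (sub-cong
  ⟪ (λ { zero → refl ; (suc x) → sym (inst-wkλ _ (tm θ x)) }) , (λ _ → refl)
  , (λ α → trans (sym (mapE-id (inst-wkλ (sub θ N)) (st θ α)))
                 (trans (sym (mapE-∘ (st θ α))) (sym (++-identityʳ _)))) ⟫ M) (sym (sub-sub M)))

sub-push : ∀ (θ : Sub m n m′ n′) E M →
           sub (θ ↑μ) (sub (push E) M) ≡ sub (push (subE θ E)) (sub (θ ↑μ) M)
sub-push θ E M = trans (sub-sub M) (trans (sub-cong
  ⟪ (λ x → sym (push-wkμ _ (tm θ x))) , (λ _ → refl)
  , (λ { zero → trans (++-identityʳ _) (mapE-comm (sub-wkμ θ) E)
       ; (suc α) → sym (trans (++-identityʳ _) (trans (mapE-∘ (st θ α)) (mapE-cong (push-wkμ _) (st θ α)))) }) ⟫ M)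
  (sym (sub-sub M)))

-- This is how a μ-abstraction that absorbs frames one after another comes to absorb a whole stack
-- at once.
push-push : ∀ (E E′ : Stack m n) M → sub (push E′) (sub (push E) M) ≡ sub (push (E ++ E′)) M
push-push E E′ M = trans (sub-sub M) (sub-cong
  ⟪ (λ _ → refl) , (λ _ → refl)
  , (λ { zero → trans (cong (_++ mapE wkμ E′) (trans (mapE-∘ E) (mapE-cong (push-wkμ E′) E)))
                      (sym (map-++ (mapF wkμ) E E′))
       ; (suc _) → refl }) ⟫ M)

push-[] : ∀ (M : Term m (suc n)) → sub (push []) M ≡ M
push-[] M = trans (sub-cong ⟪ (λ _ → refl) , (λ _ → refl) , (λ { zero → refl ; (suc _) → refl }) ⟫ M) (sub-id M)

-- Reduction and substitution

β▷ : ∀ {M : Term (suc m) n} {N} → ƛ M · N ▷ sub (inst N) M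
β▷ {M = M} {N} = subst (ƛ M · N ▷_) ([]≡inst M N) β-red

μ▷ : ∀ {M : Term m (suc n)} {N} → μ M · N ▷ μ (sub (push (argF N ∷ [])) M)
μ▷ {M = M} {N} = subst (λ X → μ M · N ▷ μ X) (=r≡push M N) μ-red

μ′▷ : ∀ {M : Term m (suc n)} {N} → N · μ M ▷ μ (sub (push (funF N ∷ [])) M)
μ′▷ {M = M} {N} = subst (λ X → N · μ M ▷ μ X) (=l≡push M N) μ′-red

plug-cong : ∀ (E : Stack m n) {M M′} → M ▷ M′ → plug E M ▷ plug E M′
plug-cong []           s = s
plug-cong (argF N ∷ E) s = plug-cong E (·-congˡ s)
plug-cong (funF N ∷ E) s = plug-cong E (·-congʳ s)

-- One step is matched by exactly one step, because each kind of contraction commutes with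
-- substitution (`sub-inst`, `sub-push`). An induction that follows an instance of a term therefore
-- decreases strictly.
▷-sub : ∀ (θ : Sub m n m′ n′) {M M′} → M ▷ M′ → sub θ M ▷ sub θ M′
▷-sub θ (β-red {M} {N}) =
  subst (sub θ (ƛ M · N) ▷_) (sym (trans (cong (sub θ) ([]≡inst M N)) (sub-inst θ N M))) β▷
▷-sub θ (μ-red {M} {N}) =
  subst (λ X → sub θ (μ M · N) ▷ μ X) (sym (trans (cong (sub (θ ↑μ)) (=r≡push M N)) (sub-push θ (argF N ∷ []) M))) μ▷
▷-sub θ (μ′-red {M} {N}) =
  subst (λ X → sub θ (N · μ M) ▷ μ X) (sym (trans (cong (sub (θ ↑μ)) (=l≡push M N)) (sub-push θ (funF N ∷ []) M))) μ′▷
▷-sub θ (ƛ-cong s)  = ƛ-cong (▷-sub (θ ↑λ) s)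
▷-sub θ (·-congˡ s) = ·-congˡ (▷-sub θ s)
▷-sub θ (·-congʳ s) = ·-congʳ (▷-sub θ s)
▷-sub θ (μ-cong s)  = μ-cong (▷-sub (θ ↑μ) s)
▷-sub θ (⟨⟩-cong {α} s) = ⟨⟩-cong (plug-cong (st θ α) (▷-sub θ s))

infix 4 _▷*_ _▷ᶠ_ _▷ᴱ_ _▷ₛ_

_▷*_ : Term m n → Term m n → Set
_▷*_ = Star _▷_

▷*-sub : ∀ (θ : Sub m n m′ n′) {M M′} → M ▷* M′ → sub θ M ▷* sub θ M′
▷*-sub θ = gmap (sub θ) (▷-sub θ)

▷*-rename : ∀ {ρ : Fin m → Fin m′} {ϑ : Fin n → Fin n′} {M M′} → M ▷* M′ → rename ρ ϑ M ▷* rename ρ ϑ M′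
▷*-rename {M = M} {M′} s = subst₂ _▷*_ (sub-ren M) (sub-ren M′) (▷*-sub (ren _ _) s)

·-cong* : ∀ {M M′ N N′ : Term m n} → M ▷* M′ → N ▷* N′ → M · N ▷* M′ · N′
·-cong* s t = gmap (_· _) ·-congˡ s ◅◅ gmap (_ ·_) ·-congʳ t

data _▷ᶠ_ {m n} : Frame m n → Frame m n → Set where
  argF : ∀ {N N′} → N ▷* N′ → argF N ▷ᶠ argF N′
  funF : ∀ {N N′} → N ▷* N′ → funF N ▷ᶠ funF N′

_▷ᴱ_ : Stack m n → Stack m n → Set
_▷ᴱ_ = Pointwise _▷ᶠ_

plug-▷* : ∀ {E E′ : Stack m n} {M M′} → E ▷ᴱ E′ → M ▷* M′ → plug E M ▷* plug E′ M′
plug-▷* []           s = s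
plug-▷* (argF t ∷ p) s = plug-▷* p (·-cong* s t)
plug-▷* (funF t ∷ p) s = plug-▷* p (·-cong* t s)

renE-▷ : ∀ {ρ : Fin m → Fin m′} {ϑ : Fin n → Fin n′} {E E′} → E ▷ᴱ E′ → renE ρ ϑ E ▷ᴱ renE ρ ϑ E′
renE-▷ []           = []
renE-▷ (argF t ∷ p) = argF (▷*-rename t) ∷ renE-▷ p
renE-▷ (funF t ∷ p) = funF (▷*-rename t) ∷ renE-▷ p

record _▷ₛ_ (θ θ′ : Sub m n m′ n′) : Set where
  constructor ⟪_,_,_⟫
  field
    tm▷ : ∀ x → tm θ x ▷* tm θ′ x
    co≡ : co θ ≗ co θ′
    st▷ : ∀ α → st θ α ▷ᴱ st θ′ α

sub-▷* : ∀ {θ θ′ : Sub m n m′ n′} → θ ▷ₛ θ′ → ∀ M → sub θ M ▷* sub θ′ M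
sub-▷* h (var x) = _▷ₛ_.tm▷ h x
sub-▷* ⟪ t , c , s ⟫ (ƛ M) = gmap ƛ ƛ-cong (sub-▷*
  ⟪ (λ { zero → ε ; (suc x) → ▷*-rename (t x) }) , c , renE-▷ ∘ s ⟫ M)
sub-▷* h (M · N) = ·-cong* (sub-▷* h M) (sub-▷* h N)
sub-▷* ⟪ t , c , s ⟫ (μ M) = gmap μ μ-cong (sub-▷*
  ⟪ ▷*-rename ∘ t , lift-cong c , (λ { zero → [] ; (suc α) → renE-▷ (s α) }) ⟫ M)
sub-▷* h (⟨ α ⟩ M) rewrite _▷ₛ_.co≡ h α =
  gmap (⟨ _ ⟩_) ⟨⟩-cong (plug-▷* (_▷ₛ_.st▷ h α) (sub-▷* h M))

inst-▷* : ∀ {N N′ : Term m n} {M M′} → N ▷* N′ → M ▷* M′ → sub (inst N) M ▷* sub (inst N′) M′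
inst-▷* {M = M} t s =
  sub-▷* ⟪ (λ { zero → t ; (suc _) → ε }) , (λ _ → refl) , (λ _ → []) ⟫ M ◅◅ ▷*-sub (inst _) s

push-▷* : ∀ {E E′ : Stack m n} {M M′} → E ▷ᴱ E′ → M ▷* M′ → sub (push E) M ▷* sub (push E′) M′
push-▷* {M = M} p s =
  sub-▷* ⟪ (λ _ → ε) , (λ _ → refl) , (λ { zero → renE-▷ p ; (suc _) → [] }) ⟫ M ◅◅ ▷*-sub (push _) s

-- Strong normalization and evaluation

Tm : Set
Tm = Σ ℕ λ m → Σ ℕ λ n → Term m n

infix 4 _≺_ _≺⁺_

-- Reduction and passage to immediate subterms are joined, so that a single induction reaches
-- subterms of reducts. Bodies of binders live in a larger scope, whence the packing in `Tm`.
data _≺_ : Tm → Tm → Set where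
  red     : ∀ {M M′ : Term m n} → M ▷ M′ → (m , n , M′) ≺ (m , n , M)
  ƛ-body  : ∀ {M : Term (suc m) n} → (suc m , n , M) ≺ (m , n , ƛ M)
  μ-body  : ∀ {M : Term m (suc n)} → (m , suc n , M) ≺ (m , n , μ M)
  ⟨⟩-body : ∀ {α} {M : Term m n} → (m , n , M) ≺ (m , n , ⟨ α ⟩ M)
  fun     : ∀ {M N : Term m n} → (m , n , M) ≺ (m , n , M · N)
  arg     : ∀ {M N : Term m n} → (m , n , N) ≺ (m , n , M · N)

_≺⁺_ : Tm → Tm → Set
_≺⁺_ = TransClosure _≺_

SN : Term m n → Set
SN M = Acc _≺_ (_ , _ , M)

sn-▷* : ∀ {M M′ : Term m n} → M ▷* M′ → SN M → SN M′
sn-▷* ε       a        = a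
sn-▷* (s ◅ t) (acc rs) = sn-▷* t (rs (red s))

sn-var : ∀ {x} → SN (var {m} {n} x)
sn-var = acc λ { (red ()) }

sn-ƛ : ∀ {M : Term (suc m) n} → SN M → SN (ƛ M)
sn-ƛ a@(acc rs) = acc λ { (red (ƛ-cong s)) → sn-ƛ (rs (red s)) ; ƛ-body → a }

sn-μ : ∀ {M : Term m (suc n)} → SN M → SN (μ M)
sn-μ a@(acc rs) = acc λ { (red (μ-cong s)) → sn-μ (rs (red s)) ; μ-body → a }

sn-⟨⟩ : ∀ {α} {M : Term m n} → SN M → SN (⟨ α ⟩ M)
sn-⟨⟩ a@(acc rs) = acc λ { (red (⟨⟩-cong s)) → sn-⟨⟩ (rs (red s)) ; ⟨⟩-body → a }

≺⁺-▷* : ∀ {X} {M M′ : Term m n} → X ≺⁺ (_ , _ , M′) → M ▷* M′ → X ≺⁺ (_ , _ , M)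
≺⁺-▷* l ε       = l
≺⁺-▷* l (s ◅ t) = ≺⁺-▷* l t ∷ʳ red s

data Value (m n : ℕ) : Set where
  lam : Term (suc m) n → Value m n
  mu  : Term m (suc n) → Value m n

⌜_⌝ : Value m n → Term m n
⌜ lam M ⌝ = ƛ M
⌜ mu M ⌝  = μ M

subᵛ : Sub m n m′ n′ → Value m n → Value m′ n′
subᵛ θ (lam M) = lam (sub (θ ↑λ) M)
subᵛ θ (mu M)  = mu (sub (θ ↑μ) M)

-- Big-step evaluation of the nodes above the first binders. The rules contract
-- with the unreduced other side, so evaluation commutes with substitution on the nose.

infix 4 _⇓_ _▷ᵛ_

data _⇓_ {m n} : Term m n → Value m n → Set where
  ⇓ƛ  : ∀ {M} → ƛ M ⇓ lam M
  ⇓μ  : ∀ {M} → μ M ⇓ mu M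
  ⇓β  : ∀ {M N P v} → M ⇓ lam P → sub (inst N) P ⇓ v → M · N ⇓ v
  ⇓μr : ∀ {M N P} → M ⇓ mu P → M · N ⇓ mu (sub (push (argF N ∷ [])) P)
  ⇓μl : ∀ {M N P} → N ⇓ mu P → M · N ⇓ mu (sub (push (funF M ∷ [])) P)

⇓-sound : ∀ {M : Term m n} {v} → M ⇓ v → M ▷* ⌜ v ⌝
⇓-sound ⇓ƛ       = ε
⇓-sound ⇓μ       = ε
⇓-sound (⇓β d e) = gmap (_· _) ·-congˡ (⇓-sound d) ◅◅ (β▷ ◅ ⇓-sound e)
⇓-sound (⇓μr d)  = gmap (_· _) ·-congˡ (⇓-sound d) ◅◅ (μ▷ ◅ ε)
⇓-sound (⇓μl d)  = gmap (_ ·_) ·-congʳ (⇓-sound d) ◅◅ (μ′▷ ◅ ε)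

data _▷ᵛ_ {m n} : Value m n → Value m n → Set where
  lam : ∀ {M M′} → M ▷* M′ → lam M ▷ᵛ lam M′
  mu  : ∀ {M M′} → M ▷* M′ → mu M ▷ᵛ mu M′

▷ᵛ-trans : ∀ {u v w : Value m n} → u ▷ᵛ v → v ▷ᵛ w → u ▷ᵛ w
▷ᵛ-trans (lam s) (lam t) = lam (s ◅◅ t)
▷ᵛ-trans (mu s)  (mu t)  = mu (s ◅◅ t)

ƛ-▷* : ∀ {M : Term (suc m) n} v {W} → ƛ M ▷* W → W ≡ ⌜ v ⌝ → lam M ▷ᵛ v
ƛ-▷* (lam _) ε              refl = lam ε
ƛ-▷* v       (ƛ-cong s ◅ t) e    = ▷ᵛ-trans (lam (s ◅ ε)) (ƛ-▷* v t e)

μ-▷* : ∀ {M : Term m (suc n)} v {W} → μ M ▷* W → W ≡ ⌜ v ⌝ → mu M ▷ᵛ v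
μ-▷* (mu _) ε              refl = mu ε
μ-▷* v      (μ-cong s ◅ t) e    = ▷ᵛ-trans (mu (s ◅ ε)) (μ-▷* v t e)

⟨⟩-▷* : ∀ {α} {M : Term m n} v {W} → ⟨ α ⟩ M ▷* W → W ≢ ⌜ v ⌝
⟨⟩-▷* (lam _) ε               ()
⟨⟩-▷* (mu _)  ε               ()
⟨⟩-▷* v       (⟨⟩-cong s ◅ t) = ⟨⟩-▷* v t

-- A reduction of an application is split at its first contraction at the root; up to that point the
-- two sides reduce independently.
data AppStar {m n} (M N : Term m n) : Term m n → Set where
  inner   : ∀ {M′ N′} → AppStar M N (M′ · N′)
  fire-β  : ∀ {P N′ W} → M ▷* ƛ P → N ▷* N′ → sub (inst N′) P ▷* W → AppStar M N W
  fire-μ  : ∀ {P N′ W} → M ▷* μ P → N ▷* N′ → μ (sub (push (argF N′ ∷ [])) P) ▷* W → AppStar M N W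
  fire-μ′ : ∀ {P M′ W} → N ▷* μ P → M ▷* M′ → μ (sub (push (funF M′ ∷ [])) P) ▷* W → AppStar M N W

appStar : ∀ {M N M′ N′ W : Term m n} → M ▷* M′ → N ▷* N′ → M′ · N′ ▷* W → AppStar M N W
appStar s t ε = inner
appStar s t (β-red {P} {N′} ◅ u)  = fire-β s t (subst (_▷* _) ([]≡inst P N′) u)
appStar s t (μ-red {P} {N′} ◅ u)  = fire-μ s t (subst (λ X → μ X ▷* _) (=r≡push P N′) u)
appStar s t (μ′-red {P} {N′} ◅ u) = fire-μ′ t s (subst (λ X → μ X ▷* _) (=l≡push P N′) u)
appStar s t (·-congˡ r ◅ u)       = appStar (s ◅◅ (r ◅ ε)) t u
appStar s t (·-congʳ r ◅ u)       = appStar s (t ◅◅ (r ◅ ε)) u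

app≢value : ∀ {M N : Term m n} v → M · N ≢ ⌜ v ⌝
app≢value (lam _) ()
app≢value (mu _)  ()

-- Root contractions can be done first, with the other side unreduced, and the inner steps
-- afterwards inside the result, as reduction passes through substitutions. The equation `W ≡ ⌜ v ⌝`
-- leaves the endpoint of the reduction open for matching.
standardize⁺ : ∀ {M : Term m n} {W} → Acc _≺⁺_ (_ , _ , M) → ∀ v → M ▷* W → W ≡ ⌜ v ⌝ → ∃ λ u → M ⇓ u × u ▷ᵛ v
standardize⁺ {M = var x} a (lam _) ε ()
standardize⁺ {M = var x} a (mu _)  ε ()
standardize⁺ {M = ƛ M}     a v s e = _ , ⇓ƛ , ƛ-▷* v s e
standardize⁺ {M = μ M}     a v s e = _ , ⇓μ , μ-▷* v s e
standardize⁺ {M = ⟨ α ⟩ M} a v s e = contradiction e (⟨⟩-▷* v s)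
standardize⁺ {M = M · N} (acc rs) v s e with appStar ε ε s
... | inner = contradiction e (app≢value v)
... | fire-β {P} s₁ s₂ s₃ with standardize⁺ (rs ⟦ fun ⟧) (lam P) s₁ refl
-- With `N` unreduced, `sub (inst N) P₀` is a proper reduct of `M · N` and still reduces to the
-- value.
...   | lam P₀ , d , lam p
        with standardize⁺ (rs (≺⁺-▷* ⟦ red β▷ ⟧ (gmap (_· N) ·-congˡ (⇓-sound d)))) v (inst-▷* s₂ p ◅◅ s₃) e
...     | u , d′ , q = u , ⇓β d d′ , q
standardize⁺ {M = M · N} (acc rs) v s e | fire-μ {P} s₁ s₂ s₃ with standardize⁺ (rs ⟦ fun ⟧) (mu P) s₁ refl
-- A μ-contraction already yields a value, so the rest of the reduction takes place under the new μ.
... | mu P₀ , d , mu p = _ , ⇓μr d , μ-▷* v (gmap μ μ-cong (push-▷* (argF s₂ ∷ []) p) ◅◅ s₃) e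
standardize⁺ {M = M · N} (acc rs) v s e | fire-μ′ {P} s₁ s₂ s₃ with standardize⁺ (rs ⟦ arg ⟧) (mu P) s₁ refl
... | mu P₀ , d , mu p = _ , ⇓μl d , μ-▷* v (gmap μ μ-cong (push-▷* (funF s₂ ∷ []) p) ◅◅ s₃) e

standardize : ∀ {M : Term m n} → SN M → ∀ v → M ▷* ⌜ v ⌝ → ∃ λ u → M ⇓ u × u ▷ᵛ v
standardize a v s = standardize⁺ (accessible _≺_ a) v s refl

-- A redex `M′ · N′` may appear only after both sides have been reduced. By `standardize` its
-- contractum is reached from an evaluation of the original sides, to which the hypotheses apply.
sn-· : ∀ {M N : Term m n} → SN M → SN N → (∀ {P} → M ⇓ lam P → SN (sub (inst N) P)) →
       (∀ {P} → M · N ⇓ mu P → SN P) → SN (M · N)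
sn-· {M = M} {N} snM snN snβ snμ = go snM snN ε ε
  where
  go : ∀ {M′ N′} → SN M′ → SN N′ → M ▷* M′ → N ▷* N′ → SN (M′ · N′)
  step : ∀ {M′ N′} → SN M′ → SN N′ → M ▷* M′ → N ▷* N′ → ∀ {X} → X ≺ (_ , _ , M′ · N′) → Acc _≺_ X
  go a b s t = acc (step a b s t)
  step a b s t fun = a
  step a b s t arg = b
  step (acc rs) b s t (red (·-congˡ r)) = go (rs (red r)) b (s ◅◅ (r ◅ ε)) t
  step a (acc rs) s t (red (·-congʳ r)) = go a (rs (red r)) s (t ◅◅ (r ◅ ε))
  step a b s t (red (β-red {P} {N′})) with standardize snM (lam P) s
  ... | lam P₀ , d , lam p = subst SN (sym ([]≡inst P N′)) (sn-▷* (inst-▷* t p) (snβ d))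
  step a b s t (red (μ-red {P} {N′})) with standardize snM (mu P) s
  ... | mu P₀ , d , mu p =
    sn-μ (subst SN (sym (=r≡push P N′)) (sn-▷* (push-▷* (argF t ∷ []) p) (snμ (⇓μr d))))
  step a b s t (red (μ′-red {P} {M′})) with standardize snN (mu P) t
  ... | mu P₀ , d , mu p =
    sn-μ (subst SN (sym (=l≡push P M′)) (sn-▷* (push-▷* (funF s ∷ []) p) (snμ (⇓μl d))))

-- Evaluation of a substitution instance

-- Evaluation that stops at a free variable instead of a binder. Either side of an application may
-- be followed, as a μ-abstraction put for the variable can be contracted on either side.
data Neutral {m n} : Term m n → Stack m n → Fin m → Set where
  ne-var : ∀ {x} → Neutral (var x) [] x
  ne-β   : ∀ {M N P E x} → M ⇓ lam P → Neutral (sub (inst N) P) E x → Neutral (M · N) E x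
  ne-fun : ∀ {M N E x} → Neutral M E x → Neutral (M · N) (E ++ argF N ∷ []) x
  ne-arg : ∀ {M N E x} → Neutral N E x → Neutral (M · N) (E ++ funF M ∷ []) x

neutral-sound : ∀ {M : Term m n} {E x} → Neutral M E x → M ▷* plug E (var x)
neutral-sound ne-var = ε
neutral-sound (ne-β d k) = gmap (_· _) ·-congˡ (⇓-sound d) ◅◅ (β▷ ◅ neutral-sound k)
neutral-sound {M = M · N} (ne-fun {E = E} {x} k) =
  subst (M · N ▷*_) (sym (plug-++ E _)) (gmap (_· _) ·-congˡ (neutral-sound k))
neutral-sound {M = M · N} (ne-arg {E = E} {x} k) =
  subst (M · N ▷*_) (sym (plug-++ E _)) (gmap (_ ·_) ·-congʳ (neutral-sound k))

-- How plug (subE θ E) (tm θ x) evaluates to v when tm θ x itself contributes.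

data Hole (θ : Sub m n m′ n′) : Stack m n → Fin m → Value m′ n′ → Set where
  hole-μ : ∀ {E x P} → tm θ x ⇓ mu P → Hole θ E x (mu (sub (push (subE θ E)) P))
  hole-ƛ : ∀ {x P} → tm θ x ⇓ lam P → Hole θ [] x (lam P)
  hole-β : ∀ {E x P N v} → tm θ x ⇓ lam P → plug (subE θ E) (sub (inst (sub θ N)) P) ⇓ v →
           Hole θ (argF N ∷ E) x v

subE-++ : ∀ (θ : Sub m n m′ n′) E E′ → subE θ (E ++ E′) ≡ subE θ E ++ subE θ E′
subE-++ θ = map-++ (mapF (sub θ))

plug-snoc : ∀ (θ : Sub m n m′ n′) E f {M} →
            plug (subE θ (E ++ f ∷ [])) M ≡ fill (mapF (sub θ) f) (plug (subE θ E) M)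
plug-snoc θ E f {M} = trans (cong (λ E → plug E M) (subE-++ θ E (f ∷ []))) (plug-++ (subE θ E) _)

-- The argument `h` stands for `⇓μr` or `⇓μl`. A μ-abstraction in the hole takes the new frame into
-- its stack by `push-push`; after a β-step at the hole, the frame is passed on to the evaluation
-- that follows.
hole-push : ∀ {θ : Sub m n m′ n′} {E x P} f →
            (∀ {M Q} → M ⇓ mu Q → fill (mapF (sub θ) f) M ⇓ mu (sub (push (mapF (sub θ) f ∷ [])) Q)) →
            Hole θ E x (mu P) → Hole θ (E ++ f ∷ []) x (mu (sub (push (mapF (sub θ) f ∷ [])) P))
hole-push {θ = θ} f h (hole-μ {E} {x} {P} d) = subst (λ X → Hole θ (E ++ f ∷ []) x (mu X))
  (trans (cong (λ F → sub (push F) P) (subE-++ θ E (f ∷ []))) (sym (push-push (subE θ E) _ P)))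
  (hole-μ d)
hole-push {θ = θ} f h (hole-β {E} d e) = hole-β d (subst (_⇓ _) (sym (plug-snoc θ E f)) (h e))

hole-app : ∀ {θ : Sub m n m′ n′} {E x P N v} → Hole θ E x (lam P) → sub (inst (sub θ N)) P ⇓ v →
           Hole θ (E ++ argF N ∷ []) x v
hole-app (hole-ƛ d) e = hole-β d e
hole-app {θ = θ} {N = N} (hole-β {E} d e₁) e = hole-β d (subst (_⇓ _) (sym (plug-snoc θ E (argF N))) (⇓β e₁ e))

-- Either the abstractions evaluated come from `M`, and the evaluation is the image of one of `M`,
-- or a variable comes to the head and its instance contributes the abstraction. The induction is on
-- the derivation.
⇓-sub⁻¹ : ∀ (θ : Sub m n m′ n′) M {W v} → W ⇓ v → W ≡ sub θ M →
          (∃ λ u → M ⇓ u × v ≡ subᵛ θ u) ⊎ (∃₂ λ E x → Neutral M E x × Hole θ E x v)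
⇓-sub⁻¹ θ (var x) {v = lam P} d refl = inj₂ (_ , _ , ne-var , hole-ƛ d)
⇓-sub⁻¹ θ (var x) {v = mu P}  d refl =
  inj₂ (_ , _ , ne-var , subst (λ X → Hole θ [] x (mu X)) (push-[] P) (hole-μ d))
⇓-sub⁻¹ θ (ƛ M) ⇓ƛ refl = inj₁ (_ , ⇓ƛ , refl)
⇓-sub⁻¹ θ (μ M) ⇓μ refl = inj₁ (_ , ⇓μ , refl)
⇓-sub⁻¹ θ (M · N) (⇓β d e) refl with ⇓-sub⁻¹ θ M d refl
... | inj₂ (E , x , k , h) = inj₂ (_ , _ , ne-fun k , hole-app h e)
-- The contractum is again an instance under `θ`, so the second derivation is inverted in the same
-- way.
... | inj₁ (lam P , d₀ , refl) with ⇓-sub⁻¹ θ (sub (inst N) P) e (sym (sub-inst θ N P))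
...   | inj₁ (u , e₀ , eq)      = inj₁ (u , ⇓β d₀ e₀ , eq)
...   | inj₂ (E , x , k , h)    = inj₂ (E , x , ne-β d₀ k , h)
⇓-sub⁻¹ θ (M · N) (⇓μr d) refl with ⇓-sub⁻¹ θ M d refl
... | inj₂ (E , x , k , h)     = inj₂ (_ , _ , ne-fun k , hole-push (argF N) ⇓μr h)
... | inj₁ (mu P , d₀ , refl)  = inj₁ (_ , ⇓μr d₀ , cong mu (sym (sub-push θ (argF N ∷ []) P)))
⇓-sub⁻¹ θ (M · N) (⇓μl d) refl with ⇓-sub⁻¹ θ N d refl
... | inj₂ (E , x , k , h)     = inj₂ (_ , _ , ne-arg k , hole-push (funF M) ⇓μl h)
... | inj₁ (mu P , d₀ , refl)  = inj₁ (_ , ⇓μl d₀ , cong mu (sym (sub-push θ (funF M ∷ []) P)))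

-- Typing

Maps : (Fin m → Fin m′) → Context m → Context m′ → Set
Maps ρ Γ Γ′ = ∀ {x A} → Γ Vec.[ x ]= A → Γ′ Vec.[ ρ x ]= A

private
  variable
    A B C : Type
    Γ : Context m
    Δ : Context n
    Γ′ : Context m′
    Δ′ : Context n′
    ρ : Fin m → Fin m′
    ϑ : Fin n → Fin n′

maps-lift : Maps ρ Γ Γ′ → Maps (lift ρ) (A ∷ Γ) (A ∷ Γ′)
maps-lift r here      = here
maps-lift r (there p) = there (r p)

⊢-rename : Maps ρ Γ Γ′ → Maps ϑ Δ Δ′ → ∀ {M} → Γ ∣ Δ ⊢ M ∶ A → Γ′ ∣ Δ′ ⊢ rename ρ ϑ M ∶ A
⊢-rename r q (⊢var p)   = ⊢var (r p)
⊢-rename r q (⊢ƛ d)     = ⊢ƛ (⊢-rename (maps-lift r) q d)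
⊢-rename r q (⊢· d e)   = ⊢· (⊢-rename r q d) (⊢-rename r q e)
⊢-rename r q (⊢μ d)     = ⊢μ (⊢-rename r (maps-lift q) d)
⊢-rename r q (⊢⟨⟩ p d)  = ⊢⟨⟩ (q p) (⊢-rename r q d)

infix 4 _∣_⊢ˢ_∶_↝_

data _∣_⊢ˢ_∶_↝_ {m n} (Γ : Context m) (Δ : Context n) : Stack m n → Type → Type → Set where
  []   : Γ ∣ Δ ⊢ˢ [] ∶ A ↝ A
  argF : ∀ {N E} → Γ ∣ Δ ⊢ N ∶ A → Γ ∣ Δ ⊢ˢ E ∶ B ↝ C → Γ ∣ Δ ⊢ˢ argF N ∷ E ∶ A ⇒ B ↝ C
  funF : ∀ {N E} → Γ ∣ Δ ⊢ N ∶ A ⇒ B → Γ ∣ Δ ⊢ˢ E ∶ B ↝ C → Γ ∣ Δ ⊢ˢ funF N ∷ E ∶ A ↝ C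

⊢-plug : ∀ {E M} → Γ ∣ Δ ⊢ˢ E ∶ A ↝ B → Γ ∣ Δ ⊢ M ∶ A → Γ ∣ Δ ⊢ plug E M ∶ B
⊢-plug []         d = d
⊢-plug (argF e s) d = ⊢-plug s (⊢· d e)
⊢-plug (funF e s) d = ⊢-plug s (⊢· e d)

⊢-unplug : ∀ E {M} → Γ ∣ Δ ⊢ plug E M ∶ B → ∃ λ A → Γ ∣ Δ ⊢ M ∶ A × Γ ∣ Δ ⊢ˢ E ∶ A ↝ B
⊢-unplug []           d = _ , d , []
⊢-unplug (argF N ∷ E) d with ⊢-unplug E d
... | _ , ⊢· a b , s = _ , a , argF b s
⊢-unplug (funF N ∷ E) d with ⊢-unplug E d
... | _ , ⊢· a b , s = _ , b , funF a s

⊢ˢ-map : {f : Term m n → Term m′ n′} → (∀ {M C} → Γ ∣ Δ ⊢ M ∶ C → Γ′ ∣ Δ′ ⊢ f M ∶ C) →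
         ∀ {E} → Γ ∣ Δ ⊢ˢ E ∶ A ↝ B → Γ′ ∣ Δ′ ⊢ˢ mapE f E ∶ A ↝ B
⊢ˢ-map h []         = []
⊢ˢ-map h (argF d s) = argF (h d) (⊢ˢ-map h s)
⊢ˢ-map h (funF d s) = funF (h d) (⊢ˢ-map h s)

⊢-wkλ : ∀ {M} → Γ ∣ Δ ⊢ M ∶ A → B ∷ Γ ∣ Δ ⊢ wkλ M ∶ A
⊢-wkλ = ⊢-rename there id

⊢-wkμ : ∀ {M} → Γ ∣ Δ ⊢ M ∶ A → Γ ∣ B ∷ Δ ⊢ wkμ M ∶ A
⊢-wkμ = ⊢-rename id there

-- Pushing a stack changes the type of a μ-variable from that of the hole to that of the filled
-- stack.
record ⊢Sub (Γ : Context m) (Δ : Context n) (Γ′ : Context m′) (Δ′ : Context n′) (θ : Sub m n m′ n′) : Set where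
  field
    ⊢tm : ∀ {x A} → Γ Vec.[ x ]= A → Γ′ ∣ Δ′ ⊢ tm θ x ∶ A
    ⊢st : ∀ {α A} → Δ Vec.[ α ]= A → ∃ λ B → Δ′ Vec.[ co θ α ]= B × Γ′ ∣ Δ′ ⊢ˢ st θ α ∶ A ↝ B

open ⊢Sub

⊢↑λ : ∀ {θ} → ⊢Sub Γ Δ Γ′ Δ′ θ → ⊢Sub (A ∷ Γ) Δ (A ∷ Γ′) Δ′ (θ ↑λ)
⊢↑λ h .⊢tm here      = ⊢var here
⊢↑λ h .⊢tm (there p) = ⊢-wkλ (⊢tm h p)
⊢↑λ h .⊢st q with ⊢st h q
... | B , q′ , s = B , q′ , ⊢ˢ-map ⊢-wkλ s

⊢↑μ : ∀ {θ} → ⊢Sub Γ Δ Γ′ Δ′ θ → ⊢Sub Γ (A ∷ Δ) Γ′ (A ∷ Δ′) (θ ↑μ)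
⊢↑μ h .⊢tm p = ⊢-wkμ (⊢tm h p)
⊢↑μ h .⊢st here = _ , here , []
⊢↑μ h .⊢st (there q) with ⊢st h q
... | B , q′ , s = B , there q′ , ⊢ˢ-map ⊢-wkμ s

⊢-sub : ∀ {θ} → ⊢Sub Γ Δ Γ′ Δ′ θ → ∀ {M} → Γ ∣ Δ ⊢ M ∶ A → Γ′ ∣ Δ′ ⊢ sub θ M ∶ A
⊢-sub h (⊢var p)  = ⊢tm h p
⊢-sub h (⊢ƛ d)    = ⊢ƛ (⊢-sub (⊢↑λ h) d)
⊢-sub h (⊢· d e)  = ⊢· (⊢-sub h d) (⊢-sub h e)
⊢-sub h (⊢μ d)    = ⊢μ (⊢-sub (⊢↑μ h) d)
⊢-sub h (⊢⟨⟩ q d) with ⊢st h q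
... | B , q′ , s = ⊢⟨⟩ q′ (⊢-plug s (⊢-sub h d))

⊢inst : ∀ {N} → Γ ∣ Δ ⊢ N ∶ A → ⊢Sub (A ∷ Γ) Δ Γ Δ (inst N)
⊢inst d .⊢tm here      = d
⊢inst d .⊢tm (there p) = ⊢var p
⊢inst d .⊢st q         = _ , q , []

⊢push : ∀ {E} → Γ ∣ Δ ⊢ˢ E ∶ A ↝ B → ⊢Sub Γ (A ∷ Δ) Γ (B ∷ Δ) (push E)
⊢push s .⊢tm p         = ⊢var p
⊢push s .⊢st here      = _ , here , ⊢ˢ-map ⊢-wkμ s
⊢push s .⊢st (there q) = _ , there q , []

⊢-▷ : ∀ {M M′} → Γ ∣ Δ ⊢ M ∶ A → M ▷ M′ → Γ ∣ Δ ⊢ M′ ∶ A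
⊢-▷ (⊢· (⊢ƛ d) e) (β-red {M} {N}) = subst (_ ∣ _ ⊢_∶ _) (sym ([]≡inst M N)) (⊢-sub (⊢inst e) d)
⊢-▷ (⊢· (⊢μ d) e) (μ-red {M} {N}) =
  ⊢μ (subst (_ ∣ _ ⊢_∶ _) (sym (=r≡push M N)) (⊢-sub (⊢push (argF e [])) d))
⊢-▷ (⊢· d (⊢μ e)) (μ′-red {M} {N}) =
  ⊢μ (subst (_ ∣ _ ⊢_∶ _) (sym (=l≡push M N)) (⊢-sub (⊢push (funF d [])) e))
⊢-▷ (⊢ƛ d)    (ƛ-cong s)  = ⊢ƛ (⊢-▷ d s)
⊢-▷ (⊢· d e)  (·-congˡ s) = ⊢· (⊢-▷ d s) e
⊢-▷ (⊢· d e)  (·-congʳ s) = ⊢· d (⊢-▷ e s)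
⊢-▷ (⊢μ d)    (μ-cong s)  = ⊢μ (⊢-▷ d s)
⊢-▷ (⊢⟨⟩ q d) (⟨⟩-cong s) = ⊢⟨⟩ q (⊢-▷ d s)

⊢-▷* : ∀ {M M′} → Γ ∣ Δ ⊢ M ∶ A → M ▷* M′ → Γ ∣ Δ ⊢ M′ ∶ A
⊢-▷* d ε       = d
⊢-▷* d (s ◅ t) = ⊢-▷* (⊢-▷ d s) t

-- Good terms

-- The variable in the hole is meant to be fresh. Quantifying over all renamings of the contexts
-- makes a fresh one available through `there` and `here`.
SNStack : Context m → Context n → Type → Stack m n → Set
SNStack Γ Δ A E = ∀ {m′ n′} {Γ′ : Context m′} {Δ′ : Context n′} {ρ ϑ} → Maps ρ Γ Γ′ → Maps ϑ Δ Δ′ →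
                  ∀ {y} → Γ′ Vec.[ y ]= A → SN (plug (renE ρ ϑ E) (var y))

snStack-rename : Maps ρ Γ Γ′ → Maps ϑ Δ Δ′ → ∀ E → SNStack Γ Δ A E → SNStack Γ′ Δ′ A (renE ρ ϑ E)
snStack-rename r q E h r′ q′ p =
  subst (λ E → SN (plug E _)) (sym (trans (mapE-∘ E) (mapE-cong rename-rename E))) (h (r′ ∘ r) (q′ ∘ q) p)

-- Both conditions are closed under renaming by construction, since goodness must survive
-- passing under binders.

record Good (Γ : Context m) (Δ : Context n) (A : Type) (M : Term m n) : Set where
  field
    ⊢good  : Γ ∣ Δ ⊢ M ∶ A
    sn-ren : ∀ {m′ n′} {Γ′ : Context m′} {Δ′ : Context n′} {ρ ϑ} → Maps ρ Γ Γ′ → Maps ϑ Δ Δ′ →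
             SN (rename ρ ϑ M)
    μ-ren  : ∀ {m′ n′} {Γ′ : Context m′} {Δ′ : Context n′} {ρ ϑ} → Maps ρ Γ Γ′ → Maps ϑ Δ Δ′ →
             ∀ {P} → rename ρ ϑ M ⇓ mu P → ∀ {E B} → Γ′ ∣ Δ′ ⊢ˢ E ∶ A ↝ B → SNStack Γ′ Δ′ A E →
             SN (sub (push E) P)

open Good

good-rename : Maps ρ Γ Γ′ → Maps ϑ Δ Δ′ → ∀ {M} → Good Γ Δ A M → Good Γ′ Δ′ A (rename ρ ϑ M)
good-rename r q {M} g .⊢good       = ⊢-rename r q (⊢good g)
good-rename r q {M} g .sn-ren r′ q′ = subst SN (sym (rename-rename M)) (sn-ren g (r′ ∘ r) (q′ ∘ q))
good-rename r q {M} g .μ-ren r′ q′ d = μ-ren g (r′ ∘ r) (q′ ∘ q) (subst (_⇓ _) (rename-rename M) d)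

rename-idᵗ : ∀ (M : Term m n) → rename id id M ≡ M
rename-idᵗ = rename-id (λ _ → refl) (λ _ → refl)

good-sn : ∀ {M} → Good Γ Δ A M → SN M
good-sn {M = M} g = subst SN (rename-idᵗ M) (sn-ren g id id)

good-μ : ∀ {M P E} → Good Γ Δ A M → M ⇓ mu P → Γ ∣ Δ ⊢ˢ E ∶ A ↝ B → SNStack Γ Δ A E → SN (sub (push E) P)
good-μ {M = M} g d = μ-ren g id id (subst (_⇓ _) (sym (rename-idᵗ M)) d)

-- Substituting good terms for variables

consₛ : Term m′ n′ → Sub m n m′ n′ → Sub (suc m) n m′ n′
consₛ M θ = ⟪ (λ { zero → M ; (suc x) → tm θ x }) , co θ , st θ ⟫

focus : Stack m n → Term (suc m) n
focus E = plug (renE suc id E) (var zero)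

sub-focus : ∀ (θ : Sub m n m′ n′) M E → sub (consₛ M θ) (focus E) ≡ plug (subE θ E) M
sub-focus θ M E = trans (sub-plug (consₛ M θ) (renE suc id E))
  (cong (λ E → plug E M) (trans (mapE-∘ E) (mapE-cong sub-rename E)))

⊢focus : ∀ {E} → Γ ∣ Δ ⊢ˢ E ∶ A ↝ B → A ∷ Γ ∣ Δ ⊢ focus E ∶ B
⊢focus s = ⊢-plug (⊢ˢ-map ⊢-wkλ s) (⊢var here)

Weight : ℕ → Set
Weight m = Fin m → ℕ

-- A new variable is never instantiated by a good term, be it bound by a λ or the variable that
-- replaces the content of a hole.
liftʷ : Weight m → Weight (suc m)
liftʷ w zero    = 0
liftʷ w (suc x) = w x

weight : Weight m → Term m n → ℕ
weight w (var x)   = w x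
weight w (ƛ M)     = weight (liftʷ w) M
weight w (M · N)   = weight w M + weight w N
weight w (μ M)     = weight w M
weight w (⟨ α ⟩ M) = weight w M

weight-rename : ∀ {w : Weight m} {w′ : Weight m′} {ρ} {ϑ : Fin n → Fin n′} → w′ ∘ ρ ≗ w →
                ∀ M → weight w′ (rename ρ ϑ M) ≡ weight w M
weight-rename h (var x)   = h x
weight-rename h (ƛ M)     = weight-rename (λ { zero → refl ; (suc x) → h x }) M
weight-rename h (M · N)   = cong₂ _+_ (weight-rename h M) (weight-rename h N)
weight-rename h (μ M)     = weight-rename h M
weight-rename h (⟨ α ⟩ M) = weight-rename h M

weight-plug-< : ∀ {w : Weight m} {w′ : Weight m′} {ρ} {ϑ : Fin n → Fin n′} → w′ ∘ ρ ≗ w →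
                ∀ E {M N} → weight w′ M < weight w N → weight w′ (plug (renE ρ ϑ E) M) < weight w (plug E N)
weight-plug-< h []           lt = lt
weight-plug-< h (argF N ∷ E) lt = weight-plug-< h E (+-mono-<-≤ lt (≤-reflexive (weight-rename h N)))
weight-plug-< h (funF N ∷ E) lt = weight-plug-< h E (+-mono-≤-< (≤-reflexive (weight-rename h N)) lt)

-- The weight is 1 exactly for the variables instantiated by a good term; weight w M
-- thus counts the special leaves of M.

data Leaf {m n} (Γ : Context m) (Δ : Context n) (A : Type) : ℕ → Type → Term m n → Set where
  regular : ∀ {C y} → Γ Vec.[ y ]= C → Leaf Γ Δ A 0 C (var y)
  special : ∀ {M} → Good Γ Δ A M → Leaf Γ Δ A 1 A M

leaf-sn : ∀ {k M} → Leaf Γ Δ A k C M → SN M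
leaf-sn (regular p) = sn-var
leaf-sn (special g) = good-sn g

⊢leaf : ∀ {k M} → Leaf Γ Δ A k C M → Γ ∣ Δ ⊢ M ∶ C
⊢leaf (regular p) = ⊢var p
⊢leaf (special g) = ⊢good g

-- A variable has no value, which leaves only the special leaves.
leaf-⇓ : ∀ {k M v} → Leaf Γ Δ A k C M → M ⇓ v → k ≡ 1 × C ≡ A × Good Γ Δ A M
leaf-⇓ (special g) d = refl , refl , g

leaf-rename : Maps ρ Γ Γ′ → Maps ϑ Δ Δ′ → ∀ {k M} → Leaf Γ Δ A k C M → Leaf Γ′ Δ′ A k C (rename ρ ϑ M)
leaf-rename r q (regular p) = regular (r p)
leaf-rename r q (special g) = special (good-rename r q g)

-- With no stacks attached, the image of `⟨ α ⟩ M` has the image of `M` as its immediate subterm, as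
-- the induction on instances needs.
Plain : Sub m n m′ n′ → Set
Plain θ = ∀ α → st θ α ≡ []

plain-↑λ : ∀ {θ : Sub m n m′ n′} → Plain θ → Plain (θ ↑λ)
plain-↑λ h α = cong (mapE wkλ) (h α)

plain-↑μ : ∀ {θ : Sub m n m′ n′} → Plain θ → Plain (θ ↑μ)
plain-↑μ h zero    = refl
plain-↑μ h (suc α) = cong (mapE wkμ) (h α)

record Env (A : Type) (w : Weight m) (Γ : Context m) (Δ : Context n) (Γ′ : Context m′) (Δ′ : Context n′)
           (θ : Sub m n m′ n′) : Set where
  field
    leaf  : ∀ {x C} → Γ Vec.[ x ]= C → Leaf Γ′ Δ′ A (w x) C (tm θ x)
    maps  : Maps (co θ) Δ Δ′
    plain : Plain θ

open Env

env-↑λ : ∀ {w θ} → Env A w Γ Δ Γ′ Δ′ θ → Env A (liftʷ w) (C ∷ Γ) Δ (C ∷ Γ′) Δ′ (θ ↑λ)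
env-↑λ e .leaf here      = regular here
env-↑λ e .leaf (there p) = leaf-rename there id (leaf e p)
env-↑λ e .maps           = maps e
env-↑λ {θ = θ} e .plain  = plain-↑λ {θ = θ} (plain e)

env-↑μ : ∀ {w θ} → Env A w Γ Δ Γ′ Δ′ θ → Env A w Γ (C ∷ Δ) Γ′ (C ∷ Δ′) (θ ↑μ)
env-↑μ e .leaf p  = leaf-rename id there (leaf e p)
env-↑μ e .maps    = maps-lift (maps e)
env-↑μ {θ = θ} e .plain = plain-↑μ {θ = θ} (plain e)

⊢env : ∀ {w θ} → Env A w Γ Δ Γ′ Δ′ θ → ⊢Sub Γ Δ Γ′ Δ′ θ
⊢env e .⊢tm p = ⊢leaf (leaf e p)
⊢env {Γ′ = Γ′} {Δ′ = Δ′} e .⊢st {α} {A} q =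
  A , maps e q , subst (λ E → Γ′ ∣ Δ′ ⊢ˢ E ∶ A ↝ A) (sym (plain e α)) []

weight₀ : Weight (suc m)
weight₀ zero    = 1
weight₀ (suc _) = 0

env-inst : ∀ {M} → Good Γ Δ A M → Env A weight₀ (A ∷ Γ) Δ Γ Δ (inst M)
env-inst g .leaf here      = special g
env-inst g .leaf (there p) = regular p
env-inst g .maps           = id
env-inst g .plain _        = refl

env-cons : ∀ {M} → Good Γ Δ A M → Env A weight₀ (A ∷ Γ) Δ Γ Δ (consₛ M idₛ)
env-cons g .leaf here      = special g
env-cons g .leaf (there p) = regular p
env-cons g .maps           = id
env-cons g .plain _        = refl

-- `SubSN` and `AllGood` are the statements (1) and (2) of the induction on types.
SubSN : Type → Set
SubSN A = ∀ {m n m′ n′} {M : Term m n} {w} {Γ Δ B} {Γ′ : Context m′} {Δ′ : Context n′} {θ} → SN M →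
          Γ ∣ Δ ⊢ M ∶ B → Env A w Γ Δ Γ′ Δ′ θ → SN (sub θ M)

AllGood : Type → Set
AllGood A = ∀ {m n} {M : Term m n} {Γ Δ} → SN M → Γ ∣ Δ ⊢ M ∶ A → Good Γ Δ A M

-- The term `plug E M` is the instance at `M` of `focus E`, which is SN by the condition on `E` at a
-- fresh variable.
plug-good : SubSN A → ∀ {E : Stack m n} {M} → Γ ∣ Δ ⊢ˢ E ∶ A ↝ B → SNStack Γ Δ A E → Good Γ Δ A M → SN (plug E M)
plug-good sb {E} {M} s h g =
  subst SN (trans (sub-focus idₛ M E) (cong (λ E → plug E M) (mapE-id sub-id E)))
    (sb (h there id here) (⊢focus s) (env-cons g))

-- The induction is on an instance M̂ of M, then on the weight: replacing x or (x N) in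
-- M = E[x] or E[x N] by a fresh variable y leaves M̂ unchanged and lowers the weight.

Claim : Type → ℕ → Tm → Set
Claim A k (m̂ , n̂ , M̂) =
  ∀ {m n} (M : Term m n) (s : Sub m n m̂ n̂) → Plain s → sub s M ≡ M̂ →
  ∀ {m′ n′ w Γ Δ B} {Γ′ : Context m′} {Δ′ : Context n′} {θ} → weight w M ≡ k →
  Γ ∣ Δ ⊢ M ∶ B → Env A w Γ Δ Γ′ Δ′ θ → SN (sub θ M)

▷⁺⇒≺⁺ : ∀ {M M′ M″ : Term m n} → M ▷ M′ → M′ ▷* M″ → (_ , _ , M″) ≺⁺ (_ , _ , M)
▷⁺⇒≺⁺ s ε       = ⟦ red s ⟧
▷⁺⇒≺⁺ s (t ◅ u) = ▷⁺⇒≺⁺ t u ∷ʳ red s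

≺⁺-plug : ∀ (E : Stack m n) {M X} → X ≺⁺ (_ , _ , M) → X ≺⁺ (_ , _ , plug E M)
≺⁺-plug []           l = l
≺⁺-plug (argF N ∷ E) l = ≺⁺-plug E (l ∷ʳ fun)
≺⁺-plug (funF N ∷ E) l = ≺⁺-plug E (l ∷ʳ arg)

sub-⟨⟩ : ∀ {θ : Sub m n m′ n′} → Plain θ → ∀ {α M} → sub θ (⟨ α ⟩ M) ≡ ⟨ co θ α ⟩ sub θ M
sub-⟨⟩ {θ = θ} h {α} {M} = cong (λ E → ⟨ co θ α ⟩ plug E (sub θ M)) (h α)

module Step {A : Type} (smaller : ∀ {A₁ A₂} → A ≡ A₁ ⇒ A₂ → (SubSN A₁ × AllGood A₁) × (SubSN A₂ × AllGood A₂))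
  {m n m̂ n̂ m′ n′} (M : Term m n) (s : Sub m n m̂ n̂) (s-plain : Plain s)
  (w : Weight m) {Γ Δ B} {Γ′ : Context m′} {Δ′ : Context n′} {θ : Sub m n m′ n′}
  (⊢M : Γ ∣ Δ ⊢ M ∶ B) (env : Env A w Γ Δ Γ′ Δ′ θ)
  (ih : ∀ {X} → X ≺⁺ (_ , _ , sub s M) → ∀ {k} → Claim A k X)
  (ihʷ : ∀ {k} → k < weight w M → Claim A k (_ , _ , sub s M)) where

  -- The induction is applied to `focus E` with two substitutions that differ at the hole: `s′` puts
  -- the instance of `N` there, so the tracked term is that of `plug E N`, whereas `θ′` puts a
  -- regular variable, so `N` no longer counts in the weight.
  linear : ∀ {E N C W} → M ▷* W → W ≡ plug E N → 0 < weight w N → Γ ∣ Δ ⊢ˢ E ∶ C ↝ B →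
           SNStack Γ′ Δ′ C (subE θ E)
  linear {E} {N} {C} M▷*W eq pos ⊢E {Γ′ = Γ″} {Δ′ = Δ″} {ρ = ρ} {ϑ} r q {y} p =
    subst SN (trans (sub-focus _ (var y) E)
                    (cong (λ E → plug E (var y)) (sym (trans (mapE-∘ E) (mapE-cong rename-sub E)))))
      (go M▷*W eq)
    where
    s′ = consₛ (sub s N) s
    θ′ = consₛ (var y) ((ρ , ϑ) ʳ∘ θ)
    env′ : Env A (liftʷ w) (C ∷ Γ) Δ Γ″ Δ″ θ′
    env′ .leaf here      = regular p
    env′ .leaf (there i) = leaf-rename r q (leaf env i)
    env′ .maps           = q ∘ maps env
    env′ .plain α        = cong (renE ρ ϑ) (plain env α)
    eq′ : sub s′ (focus E) ≡ sub s (plug E N)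
    eq′ = trans (sub-focus s (sub s N) E) (sym (sub-plug s E))
    go : ∀ {W} → M ▷* W → W ≡ plug E N → SN (sub θ′ (focus E))
    -- With no reduction step the tracked term is unchanged and the weight drops; with at least one
    -- step the tracked term itself decreases.
    go ε refl = ihʷ (weight-plug-< (λ _ → refl) E pos) (focus E) s′ s-plain eq′ refl (⊢focus ⊢E) env′
    go (t ◅ ts) refl = ih (▷⁺⇒≺⁺ (▷-sub s t) (▷*-sub s ts)) (focus E) s′ s-plain eq′ refl (⊢focus ⊢E) env′

  -- The term put for `x` has a value, so it is a special leaf and its goodness applies to the
  -- instantiated stack. The condition on that stack is `linear` with `x`, of weight 1, in the hole.
  advance : ∀ {E x P} → Neutral M E x → tm θ x ⇓ mu P → SN (sub (push (subE θ E)) P)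
  advance {E} {x} k d with ⊢-unplug E (⊢-▷* ⊢M (neutral-sound k))
  ... | C , ⊢var p , ⊢E with leaf-⇓ (leaf env p) d
  ...   | w≡1 , refl , g =
    good-μ g d (⊢ˢ-map (⊢-sub (⊢env env)) ⊢E)
      (linear (neutral-sound k) refl (≤-reflexive (sym w≡1)) ⊢E)

  -- Since `x` has type `A` and is applied to `N`, `A` is an arrow type. The instance of `N` is good
  -- by (2) at the domain; the contractum is SN by (1) at the domain, good by (2) at the codomain,
  -- and fits into the rest of the stack by (1) at the codomain.
  exit : ∀ {E x N P} → Neutral M (argF N ∷ E) x → tm θ x ⇓ lam P →
         SN (plug (subE θ E) (sub (inst (sub θ N)) P))
  exit {E} {x} {N} {P} k d with ⊢-unplug E (⊢-▷* ⊢M (neutral-sound k))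
  ... | C , ⊢· {A = C₁} (⊢var p) ⊢N , ⊢E with leaf-⇓ (leaf env p) d
  ...   | w≡1 , refl , g with smaller refl | ⊢-▷* (⊢good g) (⇓-sound d)
  ...     | (sub₁ , good₁) , (sub₂ , good₂) | ⊢ƛ ⊢P =
    plug-good sub₂ (⊢ˢ-map (⊢-sub (⊢env env)) ⊢E)
      -- The hole now contains `x N`, whose weight is at least that of `x`.
      (linear (neutral-sound k) refl (≤-trans (≤-reflexive (sym w≡1)) (m≤m+n (w x) (weight w N))) ⊢E)
      (good₂ (sub₁ snP ⊢P (env-inst gN)) (⊢-sub (⊢inst (⊢good gN)) ⊢P))
    where
    -- `N` is a subterm of the reduct `E[x N]` of `M`.
    N≺ : (_ , _ , sub s N) ≺⁺ (_ , _ , sub s M)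
    N≺ = ≺⁺-▷* (subst (λ T → _ ≺⁺ (_ , _ , T)) (sym (sub-plug s E)) (≺⁺-plug (subE s E) ⟦ arg ⟧))
               (▷*-sub s (neutral-sound k))
    gN : Good Γ′ Δ′ C₁ (sub θ N)
    gN = good₁ (ih N≺ N s s-plain refl refl ⊢N env) (⊢-sub (⊢env env) ⊢N)
    snP : SN P
    snP = acc-inverse (sn-▷* (⇓-sound d) (good-sn g)) ƛ-body

  hole-sn : ∀ {E x P} → Neutral M E x → Hole θ E x (mu P) → SN P
  hole-sn k (hole-μ d)   = advance k d
  hole-sn k (hole-β d e) = acc-inverse (sn-▷* (⇓-sound e) (exit k d)) μ-body

  by-cases : ∀ T → Γ ∣ Δ ⊢ T ∶ B → M ≡ T → SN (sub θ T)
  by-cases (var x) (⊢var p) refl = leaf-sn (leaf env p)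
  by-cases (ƛ T) (⊢ƛ ⊢T) refl = sn-ƛ (ih ⟦ ƛ-body ⟧ T (s ↑λ) (plain-↑λ {θ = s} s-plain) refl refl ⊢T (env-↑λ env))
  by-cases (μ T) (⊢μ ⊢T) refl = sn-μ (ih ⟦ μ-body ⟧ T (s ↑μ) (plain-↑μ {θ = s} s-plain) refl refl ⊢T (env-↑μ env))
  by-cases (⟨ α ⟩ T) (⊢⟨⟩ q ⊢T) refl = subst SN (sym (sub-⟨⟩ {θ = θ} (plain env) {α} {T}))
    (sn-⟨⟩ (ih (subst (λ U → (_ , _ , sub s T) ≺⁺ (m̂ , n̂ , U)) (sym (sub-⟨⟩ {θ = s} s-plain {α} {T})) ⟦ ⟨⟩-body ⟧)
               T s s-plain refl refl ⊢T env))
  by-cases (T · N) (⊢· ⊢T ⊢N) refl =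
    sn-· (ih ⟦ fun ⟧ T s s-plain refl refl ⊢T env) (ih ⟦ arg ⟧ N s s-plain refl refl ⊢N env) β-case μ-case
    where
    β-case : ∀ {P} → sub θ T ⇓ lam P → SN (sub (inst (sub θ N)) P)
    β-case d with ⇓-sub⁻¹ θ T d refl
    ... | inj₁ (lam P₀ , d₀ , refl) = subst SN (sub-inst θ N P₀)
      (ih (≺⁺-▷* ⟦ red (▷-sub s (β▷ {M = P₀} {N})) ⟧ (▷*-sub s T·N▷*)) (sub (inst N) P₀) s s-plain refl refl
          (⊢-▷* ⊢M (T·N▷* ◅◅ (β▷ ◅ ε))) env)
      where
      T·N▷* : T · N ▷* ƛ P₀ · N
      T·N▷* = ·-cong* (⇓-sound d₀) ε
    -- The instance of `x` is itself the function, so `N` is its first argument and no stack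
    -- remains.
    ... | inj₂ (_ , _ , k , hole-ƛ d′) = exit (ne-fun k) d′
    -- The λ-abstraction results from a β-step at the hole; `exit` handles the stack extended by
    -- `N`, and the wanted contractum is a reduct of what it gives.
    ... | inj₂ (_ , _ , k , hole-β {E} d′ e) = sn-▷* (·-cong* (⇓-sound e) ε ◅◅ (β▷ ◅ ε))
      (subst SN (plug-snoc θ E (argF N)) (exit (ne-fun k) d′))
    μ-case : ∀ {P} → sub θ (T · N) ⇓ mu P → SN P
    μ-case d with ⇓-sub⁻¹ θ (T · N) d refl
    ... | inj₂ (_ , _ , k , h) = hole-sn k h
    ... | inj₁ (mu P₀ , d₀ , refl) with ⊢-▷* ⊢M (⇓-sound d₀)
    ...   | ⊢μ ⊢P = ih (≺⁺-▷* ⟦ μ-body ⟧ (▷*-sub s (⇓-sound d₀))) P₀ (s ↑μ) (plain-↑μ {θ = s} s-plain) refl refl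
                       ⊢P (env-↑μ env)

claim : (∀ {A₁ A₂} → A ≡ A₁ ⇒ A₂ → (SubSN A₁ × AllGood A₁) × (SubSN A₂ × AllGood A₂)) →
        ∀ {X} → Acc _≺⁺_ X → ∀ {k} → Acc _<_ k → Claim A k X
claim smaller a@(acc rs) (acc rk) M s s-plain refl {w = w} refl ⊢M env =
  Step.by-cases smaller M s s-plain w ⊢M env
    (λ l → claim smaller (rs l) (<-wellFounded _)) (λ l → claim smaller a (rk l)) M ⊢M refl

-- Pushing stacks through μ-variables

-- The λ-variables are only renamed, so they contribute no values. Nonempty stacks are attached only
-- to μ-variables declared with the one type `A`, for which (1) is at hand.
record StackEnv (A : Type) (Γ : Context m) (Δ : Context n) (Γ′ : Context m′) (Δ′ : Context n′)
            (θ : Sub m n m′ n′) : Set where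
  field
    ⊢sub  : ⊢Sub Γ Δ Γ′ Δ′ θ
    is-var : ∀ x → ∃ λ y → tm θ x ≡ var y
    stack  : ∀ {α C} → Δ Vec.[ α ]= C → st θ α ≡ [] ⊎ (C ≡ A × SNStack Γ′ Δ′ A (st θ α))

open StackEnv

stack-rename : ∀ {C} {Γ : Context m} {Δ : Context n} {Γ′ : Context m′} {Δ′ : Context n′} {ρ ϑ} →
               Maps ρ Γ Γ′ → Maps ϑ Δ Δ′ → ∀ E →
               E ≡ [] ⊎ (C ≡ A × SNStack Γ Δ A E) → renE ρ ϑ E ≡ [] ⊎ (C ≡ A × SNStack Γ′ Δ′ A (renE ρ ϑ E))
stack-rename r q E (inj₁ refl)    = inj₁ refl
stack-rename r q E (inj₂ (e , h)) = inj₂ (e , snStack-rename r q E h)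

stackEnv-↑λ : ∀ {θ} → StackEnv A Γ Δ Γ′ Δ′ θ → StackEnv A (C ∷ Γ) Δ (C ∷ Γ′) Δ′ (θ ↑λ)
stackEnv-↑λ e .⊢sub          = ⊢↑λ (⊢sub e)
stackEnv-↑λ e .is-var zero    = zero , refl
stackEnv-↑λ e .is-var (suc x) = _ , cong wkλ (proj₂ (is-var e x))
stackEnv-↑λ {θ = θ} e .stack {α} q  = stack-rename there id (st θ α) (stack e q)

stackEnv-↑μ : ∀ {θ} → StackEnv A Γ Δ Γ′ Δ′ θ → StackEnv A Γ (C ∷ Δ) Γ′ (C ∷ Δ′) (θ ↑μ)
stackEnv-↑μ e .⊢sub = ⊢↑μ (⊢sub e)
stackEnv-↑μ e .is-var x = _ , cong wkμ (proj₂ (is-var e x))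
stackEnv-↑μ e .stack here      = inj₁ refl
stackEnv-↑μ {θ = θ} e .stack {suc α} (there q) = stack-rename id there (st θ α) (stack e q)

stackEnv-rename : Maps ρ Γ′ Γ → Maps ϑ Δ′ Δ → ∀ {Γ″ : Context m″} {Δ″ : Context n″} {θ} →
              StackEnv A Γ″ Δ″ Γ′ Δ′ θ → StackEnv A Γ″ Δ″ Γ Δ ((ρ , ϑ) ʳ∘ θ)
stackEnv-rename r q e .⊢sub .⊢tm p = ⊢-rename r q (⊢tm (⊢sub e) p)
stackEnv-rename r q e .⊢sub .⊢st p with ⊢st (⊢sub e) p
... | B , p′ , s = B , q p′ , ⊢ˢ-map (⊢-rename r q) s
stackEnv-rename r q e .is-var x = _ , cong (rename _ _) (proj₂ (is-var e x))
stackEnv-rename r q {θ = θ} e .stack {α} p = stack-rename r q (st θ α) (stack e p)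

-- By `sub-,μ` this is the effect of letting the instance of a μ-abstraction absorb `E`.
_,μ_ : Sub m n m′ n′ → Stack m′ n′ → Sub m (suc n) m′ (suc n′)
θ ,μ E = ⟪ wkμ ∘ tm θ , lift (co θ) , (λ { zero → mapE wkμ E ; (suc α) → mapE wkμ (st θ α) }) ⟫

sub-,μ : ∀ (θ : Sub m n m′ n′) E M → sub (push E) (sub (θ ↑μ) M) ≡ sub (θ ,μ E) M
sub-,μ θ E M = trans (sub-sub M) (sub-cong
  ⟪ (λ x → push-wkμ E (tm θ x)) , (λ _ → refl)
  , (λ { zero → refl
       ; (suc α) → trans (++-identityʳ _) (trans (mapE-∘ (st θ α)) (mapE-cong (push-wkμ E) (st θ α))) }) ⟫ M)

stackEnv-,μ : ∀ {θ E} → StackEnv A Γ Δ Γ′ Δ′ θ → Γ′ ∣ Δ′ ⊢ˢ E ∶ A ↝ B → SNStack Γ′ Δ′ A E →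
          StackEnv A Γ (A ∷ Δ) Γ′ (B ∷ Δ′) (θ ,μ E)
stackEnv-,μ e ⊢E h .⊢sub .⊢tm p    = ⊢-wkμ (⊢tm (⊢sub e) p)
stackEnv-,μ e ⊢E h .⊢sub .⊢st here = _ , here , ⊢ˢ-map ⊢-wkμ ⊢E
stackEnv-,μ e ⊢E h .⊢sub .⊢st (there q) with ⊢st (⊢sub e) q
... | B , q′ , s = B , there q′ , ⊢ˢ-map ⊢-wkμ s
stackEnv-,μ e ⊢E h .is-var x        = _ , cong wkμ (proj₂ (is-var e x))
stackEnv-,μ {E = E} e ⊢E h .stack here      = inj₂ (refl , snStack-rename id there E h)
stackEnv-,μ {θ = θ} e ⊢E h .stack {suc α} (there q) = stack-rename id there (st θ α) (stack e q)

hole-var : ∀ {θ : Sub m n m′ n′} → (∀ x → ∃ λ y → tm θ x ≡ var y) → ∀ {E x v} → ¬ Hole θ E x v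
hole-var h {x = x} (hole-μ d)   with subst (_⇓ _) (proj₂ (h x)) d
... | ()
hole-var h {x = x} (hole-ƛ d)   with subst (_⇓ _) (proj₂ (h x)) d
... | ()
hole-var h {x = x} (hole-β d _) with subst (_⇓ _) (proj₂ (h x)) d
... | ()

⇓-sub-var⁻¹ : ∀ {θ : Sub m n m′ n′} → (∀ x → ∃ λ y → tm θ x ≡ var y) → ∀ M {v} → sub θ M ⇓ v →
              ∃ λ u → M ⇓ u × v ≡ subᵛ θ u
⇓-sub-var⁻¹ {θ = θ} h M d with ⇓-sub⁻¹ θ M d refl
... | inj₁ r               = r
... | inj₂ (_ , _ , _ , k) = contradiction k (hole-var h)

StackClaim : Type → Tm → Set
StackClaim A (m , n , M) = ∀ {m′ n′ Γ Δ B} {Γ′ : Context m′} {Δ′ : Context n′} {θ} →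
  Γ ∣ Δ ⊢ M ∶ B → StackEnv A Γ Δ Γ′ Δ′ θ → SN (sub θ M)

-- A μ-abstraction reached from `sub θ M` is the image of one reached from `M`, whose body lies
-- strictly below `M`. Pushing `E` through it only adds `E` to the stacks already attached, so the
-- hypothesis on terms below `M` applies.
good-sub : ∀ {M : Term m n} → StackClaim A (_ , _ , M) → (∀ {X} → X ≺⁺ (_ , _ , M) → StackClaim A X) →
           ∀ {θ} → Γ ∣ Δ ⊢ M ∶ A → StackEnv A Γ Δ Γ′ Δ′ θ → Good Γ′ Δ′ A (sub θ M)
good-sub c ih ⊢M e .⊢good = ⊢-sub (⊢sub e) ⊢M
good-sub {M = M} c ih ⊢M e .sn-ren r q = subst SN (sym (rename-sub M)) (c ⊢M (stackEnv-rename r q e))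
good-sub {M = M} c ih ⊢M e .μ-ren r q d {E} ⊢E h
  with ⇓-sub-var⁻¹ (is-var (stackEnv-rename r q e)) M (subst (_⇓ _) (rename-sub M) d)
... | mu P , d₀ , refl with ⊢-▷* ⊢M (⇓-sound d₀)
...   | ⊢μ ⊢P = subst SN (sym (sub-,μ _ E P))
  (ih (≺⁺-▷* ⟦ μ-body ⟧ (⇓-sound d₀)) ⊢P (stackEnv-,μ (stackEnv-rename r q e) ⊢E h))

stackClaim : SubSN A → ∀ {X} → Acc _≺⁺_ X → StackClaim A X
stackClaim sb {_ , _ , var x} (acc rs) (⊢var p) e with is-var e x
... | y , eq = subst SN (sym eq) sn-var
stackClaim sb {_ , _ , ƛ M} (acc rs) (⊢ƛ ⊢M) e = sn-ƛ (stackClaim sb (rs ⟦ ƛ-body ⟧) ⊢M (stackEnv-↑λ e))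
stackClaim sb {_ , _ , μ M} (acc rs) (⊢μ ⊢M) e = sn-μ (stackClaim sb (rs ⟦ μ-body ⟧) ⊢M (stackEnv-↑μ e))
stackClaim sb {_ , _ , ⟨ α ⟩ M} (acc rs) {θ = θ} (⊢⟨⟩ q ⊢M) e with stack e q | ⊢st (⊢sub e) q
... | inj₁ eq | _ = subst (λ E → SN (⟨ co θ α ⟩ plug E (sub θ M))) (sym eq)
  (sn-⟨⟩ (stackClaim sb (rs ⟦ ⟨⟩-body ⟧) ⊢M e))
-- The instance of `M` is good by the induction hypotheses for `M` and the terms below it, so (1)
-- allows it to be plugged into the stack.
... | inj₂ (refl , h) | _ , _ , ⊢E = sn-⟨⟩ (plug-good sb ⊢E h
  (good-sub (stackClaim sb (rs ⟦ ⟨⟩-body ⟧)) (λ l → stackClaim sb (rs (l ∷ʳ ⟨⟩-body))) ⊢M e))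
stackClaim sb {_ , _ , M · N} (acc rs) {θ = θ} ⊢MN@(⊢· ⊢M ⊢N) e =
  sn-· (stackClaim sb (rs ⟦ fun ⟧) ⊢M e) (stackClaim sb (rs ⟦ arg ⟧) ⊢N e) β-case μ-case
  where
  β-case : ∀ {P} → sub θ M ⇓ lam P → SN (sub (inst (sub θ N)) P)
  β-case d with ⇓-sub-var⁻¹ (is-var e) M d
  ... | lam P₀ , d₀ , refl = subst SN (sub-inst θ N P₀)
    (stackClaim sb (rs (≺⁺-▷* ⟦ red β▷ ⟧ MN▷*)) (⊢-▷* ⊢MN (MN▷* ◅◅ (β▷ ◅ ε))) e)
    where
    MN▷* : M · N ▷* ƛ P₀ · N
    MN▷* = ·-cong* (⇓-sound d₀) ε
  μ-case : ∀ {P} → sub θ (M · N) ⇓ mu P → SN P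
  μ-case d with ⇓-sub-var⁻¹ (is-var e) (M · N) d
  ... | mu P₀ , d₀ , refl with ⊢-▷* ⊢MN (⇓-sound d₀)
  ...   | ⊢μ ⊢P = stackClaim sb (rs (≺⁺-▷* ⟦ μ-body ⟧ (⇓-sound d₀))) ⊢P (stackEnv-↑μ e)

-- Induction on types and strong normalization of typed terms

stackEnv-id : StackEnv A Γ Δ Γ Δ idₛ
stackEnv-id .⊢sub .⊢tm p = ⊢var p
stackEnv-id .⊢sub .⊢st q = _ , q , []
stackEnv-id .is-var x     = x , refl
stackEnv-id .stack q      = inj₁ refl

-- Statement (1) at `A` uses both statements at the components of an arrow type; (2) at `A` then
-- uses only (1) at `A`, with the identity as stack environment.
subSN×allGood : ∀ A → SubSN A × AllGood A
subSN×allGood A = sb , λ {_} {_} {M} a ⊢M → subst (Good _ _ A) (sub-id M)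
    (good-sub (stackClaim sb (accessible _≺_ a)) (λ l → stackClaim sb (acc-inverse (accessible _≺_ a) l)) ⊢M stackEnv-id)
  where
  smaller : ∀ {A₁ A₂} → A ≡ A₁ ⇒ A₂ → (SubSN A₁ × AllGood A₁) × (SubSN A₂ × AllGood A₂)
  smaller refl = subSN×allGood _ , subSN×allGood _
  sb : SubSN A
  sb {M = M} a ⊢M e =
    claim smaller (accessible _≺_ a) (<-wellFounded _) M idₛ (λ _ → refl) (sub-id M) refl ⊢M e

sn-var·var : ∀ {x y} → SN (var {m} {n} x · var y)
sn-var·var = sn-· sn-var sn-var (λ ()) (λ { (⇓μr ()) ; (⇓μl ()) })

-- Two uses of (1): `x N` is an instance of `x y` at a good term of type `A`, and `M · N` is an
-- instance of `x N` at a good term of type `A ⇒ B`.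
sn-app : ∀ {M N} → SN M → SN N → Γ ∣ Δ ⊢ M ∶ A ⇒ B → Γ ∣ Δ ⊢ N ∶ A → SN (M · N)
sn-app {A = A} {B = B} {M = M} {N} snM snN ⊢M ⊢N = subst (λ N → SN (M · N)) (inst-wkλ M N)
  (proj₁ S⇒ sn-xN (⊢· (⊢var here) (⊢-wkλ ⊢N)) (env-inst (proj₂ S⇒ snM ⊢M)))
  where
  S⇒ : SubSN (A ⇒ B) × AllGood (A ⇒ B)
  S⇒ = subSN×allGood (A ⇒ B)
  Sᴬ : SubSN A × AllGood A
  Sᴬ = subSN×allGood A
  sn-xN : SN (var zero · wkλ N)
  sn-xN = proj₁ Sᴬ sn-var·var (⊢· {B = B} (⊢var (there here)) (⊢var here))
    (env-inst (good-rename there id (proj₂ Sᴬ snN ⊢N)))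

typed⇒sn : ∀ {M} → Γ ∣ Δ ⊢ M ∶ A → SN M
typed⇒sn (⊢var p)   = sn-var
typed⇒sn (⊢ƛ d)     = sn-ƛ (typed⇒sn d)
typed⇒sn (⊢· d e)   = sn-app (typed⇒sn d) (typed⇒sn e) d e
typed⇒sn (⊢μ d)     = sn-μ (typed⇒sn d)
typed⇒sn (⊢⟨⟩ q d)  = sn-⟨⟩ (typed⇒sn d)

sn⇒¬infinite : ∀ {M : Term m n} → SN M → StronglyNormalizing M
sn⇒¬infinite (acc rs) (f , refl , s) = sn⇒¬infinite (rs (red (s 0))) (f ∘ suc , refl , s ∘ suc)

theorem4p19 : ∀ {m n : ℕ} (M : Term m n) → Typed M → StronglyNormalizing M
theorem4p19 M (_ , _ , _ , d) = sn⇒¬infinite (typed⇒sn d)
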